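{- For any acyclic directed graph $G$, there is a bijection between the set of upward planar orders on $G$ and the set of CPP-extensions of $G$.
   Context: Directed graphs are finite; parallel edges are allowed. $s(e),t(e)$ are the starting and ending vertices of an edge $e$. For a vertex $v$, $I(v)$ and $O(v)$ are the sets of incoming and outgoing edges and $E(v)=I(v)\cup O(v)$. A source (sink) is a vertex with no incoming (outgoing) edge; $S(G)$, $T(G)$ are the sets of sources and sinks of $G$. For edges $e_1\ne e_2$, $e_1\rightarrow e_2$ means there is a directed path starting from $e_1$ and ending with $e_2$. For a finite set with a linear order $\prec$ and a nonempty subset $X$, $X^-=\min X$, $X^+=\max X$, $\overline{X}=\{y: X^-\preceq y\preceq X^+\}$; $\overline{\emptyset}=\emptyset$. An upward planar order on $G$ is a linear order $\prec$ on the edge set $E(G)$ such that: $(U_1)$ $e_1\rightarrow e_2$ implies $e_1\prec e_2$; $(U_2)$ for any vertex $v$, $\overline{I(v)}\cap\overline{O(v)}=\emptyset$ and $\overline{E(v)}=\overline{I(v)}\sqcup\overline{O(v)}$; $(U_3)$ for any two vertices $v_1,v_2$, $I(v_1)\cap\overline{I(v_2)}\neq\emptyset$ implies $\overline{I(v_1)}\subseteq\overline{I(v_2)}$, and $O(v_1)\cap\overline{O(v_2)}\neq\emptyset$ implies $\overline{O(v_1)}\subseteq\overline{O(v_2)}$. A processive graph is an acyclic directed graph in which all sources and sinks have degree one. For a processive graph $\Gamma$, $I(\Gamma)$ is the set of its input edges (those starting from a source) and $O(\Gamma)$ the set of its output edges (those ending with a sink). A planar order on a processive graph is a linear order $\prec$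 on its edge set such that $(P_1)$ $e_1\rightarrow e_2$ implies $e_1\prec e_2$; $(P_2)$ if $e_1\prec e_2\prec e_3$ and $e_1\rightarrow e_3$, then $e_1\rightarrow e_2$ or $e_2\rightarrow e_3$. A POP-graph is a processive graph together with a planar order. An embedding $\phi\colon G_1\to G_2$ of directed graphs is a pair of injections $\phi_0\colon V(G_1)\to V(G_2)$, $\phi_1\colon E(G_1)\to E(G_2)$ with $s(\phi_1(e))=\phi_0(s(e))$ and $t(\phi_1(e))=\phi_0(t(e))$ for all $e\in E(G_1)$. A CPP-extension (canonical processive planar extension) of $G$ is a POP-graph $(\Gamma,\prec)$ together with an embedding $\phi\colon G\to\Gamma$ such that: $(E_1)$ $\phi_0(V(G))=V(\Gamma)-(S(\Gamma)\sqcup T(\Gamma))$; $(E_2)$ $|E(\Gamma)|=|E(G)|+|S(G)|+|T(G)|$; $(E_3)$ $I(\phi_0(v))\cap O(\phi_0(w))=\emptyset$ for any $v\in S(G)$ and $w\in T(G)$; $(E_4)$ $e\in E(\Gamma)-(\phi_1(E(G))\cup I(\Gamma)\cup O(\Gamma))$ implies that either $O(s(e))^-\prec e\prec O(s(e))^+$ or $I(t(e))^-\prec e\prec I(t(e))^+$. CPP-extensions $\phi\colon G\to(\Gamma,\prec)$ and $\phi'\colon G\to(\Gamma',\prec')$ are identified when there is an order-preserving isomorphism of directed graphs $\lambda\colon\Gamma\to\Gamma'$ with $\phi'=\lambda\circ\phi$.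
   Formalization: The theorem is proved for acyclic directed graphs with no isolated vertices; otherwise it fails: the graph with two isolated vertices and no edges has one upward planar order but two CPP-extensions. -}

module Defs where

open import Level using (0ℓ; suc)
open import Data.Nat.Base using (ℕ; _+_)
open import Data.Fin.Base using (Fin)
open import Data.Fin.Properties using (_≟_; all?)
open import Data.List.Base using (length; filter; allFin)
open import Data.Product.Base using (_×_; ∃-syntax)
open import Data.Sum.Base using (_⊎_)
open import Data.Empty using (⊥-elim)
open import Function.Base using (id; _∘_)
open import Function.Bundles using (_⇔_; _↔_; Inverse)
open import Function.Definitions using (Injective)
open import Function.Properties.Inverse using (↔-refl; ↔-sym; ↔-trans)
import Function.Properties.Equivalence as ⇔
open import Relation.Nullary.Negation.Core using (¬_)
open import Relation.Nullary.Decidable.Core using (¬?)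
open import Relation.Unary
  using (Pred; Decidable; _∈_; _∉_; _⊆_; _∪_; ∁; _≐_; _≬_)
open import Relation.Binary.Core using (Rel)
open import Relation.Binary.Bundles using (Setoid)
open import Relation.Binary.Definitions using (tri<; tri≈; tri>)
open import Relation.Binary.Structures using (IsStrictTotalOrder)
open import Relation.Binary.Construct.Closure.Transitive using (TransClosure)
import Relation.Binary.Construct.StrictToNonStrict as StrictToNonStrict
open import Relation.Binary.PropositionalEquality
  using (_≡_; _≢_; refl; sym; trans; cong; subst₂)

-- Finite directed multigraphs: vertices and edges are numbered, and since
-- edges have their own identity, parallel edges are allowed.
record Digraph : Set where
  field
    #V #E : ℕ

  V : Set
  V = Fin #V

  E : Set
  E = Fin #E

  field
    s t : E → V

card : ∀ {n} {P : Pred (Fin n) 0ℓ} → Decidable P → ℕ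
card {n} P? = length (filter P? (allFin n))

module Graph (G : Digraph) where
  open Digraph G public

  In Out Inc : V → Pred E 0ℓ
  In  v e = t e ≡ v
  Out v e = s e ≡ v
  Inc v   = In v ∪ Out v

  in? : ∀ v → Decidable (In v)
  in? v e = t e ≟ v

  out? : ∀ v → Decidable (Out v)
  out? v e = s e ≟ v

  -- A loop, were there one, would count twice, as usual.
  degree : V → ℕ
  degree v = card (in? v) + card (out? v)

  Source Sink : Pred V 0ℓ
  Source v = ∀ e → e ∉ In v
  Sink   v = ∀ e → e ∉ Out v

  source? : Decidable Source
  source? v = all? (λ e → ¬? (in? v e))

  sink? : Decidable Sink
  sink? v = all? (λ e → ¬? (out? v e))

  InputEdge OutputEdge : Pred E 0ℓ
  InputEdge  e = Source (s e)
  OutputEdge e = Sink (t e)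

  Consecutive : Rel E 0ℓ
  Consecutive e f = t e ≡ s f

  infix 4 _⇝_

  -- The relation written e₁ → e₂ in the literature.
  _⇝_ : Rel E 0ℓ
  e₁ ⇝ e₂ = e₁ ≢ e₂ × TransClosure Consecutive e₁ e₂

  -- A closed directed walk through e is a chain of consecutive edges
  -- returning to e; loops are the chains of length one.
  Acyclic : Set
  Acyclic = ∀ e → ¬ TransClosure Consecutive e e

  -- No vertex of degree zero.  Such a vertex lies in both S(G) and T(G), so a
  -- CPP-extension attaches an input and an output edge to it, and these can be
  -- ordered relative to the other edges in ways that an order on E(G) does not
  -- record: two isolated vertices have one upward planar order but two
  -- CPP-extensions.
  NoIsolatedVertices : Set
  NoIsolatedVertices = ∀ v → ¬ (v ∈ Source × v ∈ Sink)

  record Processive : Set where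
    field
      acyclic       : Acyclic
      source-degree : ∀ {v} → v ∈ Source → degree v ≡ 1
      sink-degree   : ∀ {v} → v ∈ Sink → degree v ≡ 1

module Order {A : Set} (_≺_ : Rel A 0ℓ) where
  open StrictToNonStrict _≡_ _≺_ public using () renaming (_≤_ to _≼_)

  -- IsMin X a says a = X⁻, and IsMax X b says b = X⁺.
  IsMin IsMax : Pred A 0ℓ → Pred A 0ℓ
  IsMin X a = a ∈ X × (∀ {x} → x ∈ X → a ≼ x)
  IsMax X b = b ∈ X × (∀ {x} → x ∈ X → x ≼ b)

  -- The closed interval [X⁻, X⁺].  It is empty when X is, as X then has
  -- no minimum.
  Hull : Pred A 0ℓ → Pred A 0ℓ
  Hull X y = ∃[ a ] ∃[ b ] (IsMin X a × IsMax X b × a ≼ y × y ≼ b)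

  -- X⁻ ≺ y ≺ X⁺.
  StrictlyInside : Pred A 0ℓ → Pred A 0ℓ
  StrictlyInside X y = ∃[ a ] ∃[ b ] (IsMin X a × IsMax X b × a ≺ y × y ≺ b)

record UpwardPlanarOrder (G : Digraph) : Set₁ where
  open Graph G
  infix 4 _≺_
  field
    _≺_                : Rel E 0ℓ
    isStrictTotalOrder : IsStrictTotalOrder _≡_ _≺_
  open Order _≺_ public
  field
    U₁          : ∀ {e₁ e₂} → e₁ ⇝ e₂ → e₁ ≺ e₂
    U₂-disjoint : ∀ v → ¬ (Hull (In v) ≬ Hull (Out v))
    U₂-union    : ∀ v → Hull (Inc v) ≐ (Hull (In v) ∪ Hull (Out v))
    U₃-in       : ∀ v₁ v₂ → In v₁ ≬ Hull (In v₂) → Hull (In v₁) ⊆ Hull (In v₂)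
    U₃-out      : ∀ v₁ v₂ → Out v₁ ≬ Hull (Out v₂) → Hull (Out v₁) ⊆ Hull (Out v₂)

record PlanarOrder (Γ : Digraph) : Set₁ where
  open Graph Γ
  infix 4 _≺_
  field
    _≺_                : Rel E 0ℓ
    isStrictTotalOrder : IsStrictTotalOrder _≡_ _≺_
    P₁ : ∀ {e₁ e₂} → e₁ ⇝ e₂ → e₁ ≺ e₂
    P₂ : ∀ {e₁ e₂ e₃} → e₁ ≺ e₂ → e₂ ≺ e₃ → e₁ ⇝ e₃ → e₁ ⇝ e₂ ⊎ e₂ ⇝ e₃
  open Order _≺_ public

record POPGraph : Set₁ where
  field
    Γ           : Digraph
    processive  : Graph.Processive Γ
    planarOrder : PlanarOrder Γ
  open PlanarOrder planarOrder public

record Embedding (G H : Digraph) : Set where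
  private
    module G = Digraph G
    module H = Digraph H
  field
    φ₀           : G.V → H.V
    φ₁           : G.E → H.E
    φ₀-injective : Injective _≡_ _≡_ φ₀
    φ₁-injective : Injective _≡_ _≡_ φ₁
    s-φ          : ∀ e → H.s (φ₁ e) ≡ φ₀ (G.s e)
    t-φ          : ∀ e → H.t (φ₁ e) ≡ φ₀ (G.t e)

Image : {A B : Set} → (A → B) → Pred B 0ℓ
Image f y = ∃[ x ] f x ≡ y

record CPPExtension (G : Digraph) : Set₁ where
  field
    pop : POPGraph
  open POPGraph pop public
  field
    embedding : Embedding G Γ
  open Embedding embedding public
  private
    module G = Graph G
    module Γ = Graph Γ
  field
    E₁ : Image φ₀ ≐ ∁ (Γ.Source ∪ Γ.Sink)
    E₂ : Γ.#E ≡ G.#E + card G.source? + card G.sink?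
    E₃ : ∀ {v w} → v ∈ G.Source → w ∈ G.Sink → ¬ (Γ.In (φ₀ v) ≬ Γ.Out (φ₀ w))
    E₄ : ∀ {e} → e ∉ Image φ₁ ∪ Γ.InputEdge ∪ Γ.OutputEdge →
         e ∈ StrictlyInside (Γ.Out (Γ.s e)) ⊎ e ∈ StrictlyInside (Γ.In (Γ.t e))

infix 4 _≈ᵁ_ _≈ᶜ_

-- Two orders are equal when they have the same graph.
_≈ᵁ_ : ∀ {G} → Rel (UpwardPlanarOrder G) 0ℓ
P ≈ᵁ Q = ∀ e f → P._≺_ e f ⇔ Q._≺_ e f
  where
  module P = UpwardPlanarOrder P
  module Q = UpwardPlanarOrder Q

record _≈ᶜ_ {G : Digraph} (X Y : CPPExtension G) : Set where
  private
    module X  = CPPExtension X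
    module Y  = CPPExtension Y
    module XΓ = Digraph X.Γ
    module YΓ = Digraph Y.Γ
  field
    vertices : XΓ.V ↔ YΓ.V
    edges    : XΓ.E ↔ YΓ.E
  λ₀ : XΓ.V → YΓ.V
  λ₀ = Inverse.to vertices
  λ₁ : XΓ.E → YΓ.E
  λ₁ = Inverse.to edges
  field
    s-λ  : ∀ e → YΓ.s (λ₁ e) ≡ λ₀ (XΓ.s e)
    t-λ  : ∀ e → YΓ.t (λ₁ e) ≡ λ₀ (XΓ.t e)
    mono : ∀ {e f} → e X.≺ f → λ₁ e Y.≺ λ₁ f
    λ∘φ₀ : ∀ v → Y.φ₀ v ≡ λ₀ (X.φ₀ v)
    λ∘φ₁ : ∀ e → Y.φ₁ e ≡ λ₁ (X.φ₁ e)

≈ᶜ-refl : ∀ {G} {X : CPPExtension G} → X ≈ᶜ X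
≈ᶜ-refl = record
  { vertices = ↔-refl
  ; edges    = ↔-refl
  ; s-λ      = λ _ → refl
  ; t-λ      = λ _ → refl
  ; mono     = id
  ; λ∘φ₀     = λ _ → refl
  ; λ∘φ₁     = λ _ → refl
  }

≈ᶜ-sym : ∀ {G} {X Y : CPPExtension G} → X ≈ᶜ Y → Y ≈ᶜ X
≈ᶜ-sym {G} {X} {Y} i = record
  { vertices = ↔-sym vertices
  ; edges    = ↔-sym edges
  ; s-λ      = λ e → sym (VI.inverseʳ (trans (cong YΓ.s (sym (EI.strictlyInverseˡ e))) (s-λ _)))
  ; t-λ      = λ e → sym (VI.inverseʳ (trans (cong YΓ.t (sym (EI.strictlyInverseˡ e))) (t-λ _)))
  ; mono     = mono⁻¹
  ; λ∘φ₀     = λ v → sym (VI.inverseʳ (λ∘φ₀ v))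
  ; λ∘φ₁     = λ e → sym (EI.inverseʳ (λ∘φ₁ e))
  }
  where
  open _≈ᶜ_ i
  module X  = CPPExtension X
  module Y  = CPPExtension Y
  module YΓ = Digraph Y.Γ
  module VI = Inverse vertices
  module EI = Inverse edges
  module XO = IsStrictTotalOrder X.isStrictTotalOrder
  module YO = IsStrictTotalOrder Y.isStrictTotalOrder

  mono⁻¹ : ∀ {e f} → e Y.≺ f → EI.from e X.≺ EI.from f
  mono⁻¹ {e} {f} e≺f with XO.compare (EI.from e) (EI.from f)
  ... | tri< lt _ _ = lt
  ... | tri≈ _ eq _ = ⊥-elim (YO.irrefl e≡f e≺f)
    where
    e≡f : e ≡ f
    e≡f = trans (sym (EI.strictlyInverseˡ e)) (EI.inverseˡ eq)
  ... | tri> _ _ gt = ⊥-elim (YO.asym e≺f f≺e)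
    where
    f≺e : f Y.≺ e
    f≺e = subst₂ Y._≺_ (EI.strictlyInverseˡ f) (EI.strictlyInverseˡ e) (mono gt)

≈ᶜ-trans : ∀ {G} {X Y Z : CPPExtension G} → X ≈ᶜ Y → Y ≈ᶜ Z → X ≈ᶜ Z
≈ᶜ-trans i j = record
  { vertices = ↔-trans I.vertices J.vertices
  ; edges    = ↔-trans I.edges J.edges
  ; s-λ      = λ e → trans (J.s-λ _) (cong J.λ₀ (I.s-λ e))
  ; t-λ      = λ e → trans (J.t-λ _) (cong J.λ₀ (I.t-λ e))
  ; mono     = J.mono ∘ I.mono
  ; λ∘φ₀     = λ v → trans (J.λ∘φ₀ v) (cong J.λ₀ (I.λ∘φ₀ v))
  ; λ∘φ₁     = λ e → trans (J.λ∘φ₁ e) (cong J.λ₁ (I.λ∘φ₁ e))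
  }
  where
  module I = _≈ᶜ_ i
  module J = _≈ᶜ_ j

UpwardPlanarOrders : Digraph → Setoid (suc 0ℓ) 0ℓ
UpwardPlanarOrders G = record
  { Carrier       = UpwardPlanarOrder G
  ; _≈_           = _≈ᵁ_
  ; isEquivalence = record
    { refl  = λ _ _ → ⇔.refl
    ; sym   = λ p e f → ⇔.sym (p e f)
    ; trans = λ p q e f → ⇔.trans (p e f) (q e f)
    }
  }

CPPExtensions : Digraph → Setoid (suc 0ℓ) 0ℓ
CPPExtensions G = record
  { Carrier       = CPPExtension G
  ; _≈_           = _≈ᶜ_
  ; isEquivalence = record
    { refl  = ≈ᶜ-refl
    ; sym   = ≈ᶜ-sym
    ; trans = ≈ᶜ-trans
    }
  }

{-# OPTIONS --safe #-}
module Submission where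

-- In a CPP-extension Γ the edges outside φ₁(E(G)) are exactly one stub into
-- every source v of G and one stub out of every sink w.  By P₂ the stub into v
-- comes immediately before min O(v) and the stub out of w immediately after
-- max I(w), so the order on E(G) determines the order on E(Γ).  It also
-- determines where the stub into v starts: among the vertices u of G with
-- O(u)⁻ ≺ min O(v) ≺ O(u)⁺ the hulls are nested, and the stub starts at the
-- innermost such u, or at a fresh source when there is none.  Conversely these
-- choices always yield a POP-graph.  The link between the two kinds of order
-- is that U₃ says that the families I(v), and likewise the families O(v), do
-- not cross; in a processive graph, together with U₂, this is equivalent to P₂
-- as soon as no input or output edge is enclosed by a family.  Everything is
-- self-dual under reversing both the edges and the order.

open import Defs
open import Level using (0ℓ)
open import Data.Nat.Base using (ℕ; zero; suc; _+_; s≤s; z≤n)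
import Data.Nat.Properties as ℕ
open import Data.Fin.Base as Fin using (Fin; zero; suc; punchOut)
open import Data.Fin.Properties as Fin
  using (_≟_; any?; all?; injective⇒≤; punchOut-injective)
open import Data.Fin.Induction using (spo-noetherian; spo-wellFounded)
open import Data.List.Base as List using (List; filter; allFin; lookup)
open import Data.List.Relation.Unary.Any using (index)
open import Data.List.Relation.Unary.Any.Properties using (lookup-index)
import Data.List.Relation.Unary.All as All
open import Data.List.Relation.Unary.AllPairs using (_∷_)
open import Data.List.Relation.Unary.Unique.Propositional using (Unique)
open import Data.List.Relation.Unary.Unique.Propositional.Properties using (allFin⁺; filter⁺)
open import Data.List.Membership.Propositional.Properties
  using (∈-lookup; ∈-filter⁺; ∈-filter⁻; ∈-allFin)
open import Data.Product.Base using (_×_; _,_; ∃; ∃-syntax; proj₁; proj₂)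
open import Data.Product.Relation.Binary.Lex.Strict using (×-Lex; ×-isStrictTotalOrder)
open import Data.Product.Relation.Binary.Pointwise.NonDependent using (≡×≡⇒≡; ≡⇒≡×≡)
open import Data.Sum.Base using (_⊎_; inj₁; inj₂; swap; [_,_]′)
open import Data.Sum.Function.Propositional using (_⊎-↔_)
open import Data.Empty using (⊥; ⊥-elim)
open import Function.Base using (_∘_; flip; _on_; id)
open import Function.Bundles
  using (_⇔_; Equivalence; mk⇔; _↔_; Inverse; mk↔ₛ′)
open import Function.Bundles using (Bijection)
open import Function.Definitions using (Injective)
open import Function.Properties.Equivalence using () renaming (sym to ⇔-sym; trans to ⇔-trans)
open import Function.Properties.Inverse using (↔-refl; ↔-trans)
open import Function.Related.TypeIsomorphisms using (⊎-assoc)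
open import Induction.WellFounded using (Acc; acc)
open import Relation.Nullary.Negation.Core using (¬_)
open import Relation.Nullary.Decidable.Core using (yes; no; _×-dec_; _⊎-dec_; ¬?)
open import Relation.Unary using (Pred; Decidable; _∈_; _⊆_; _∪_; _≬_)
open import Relation.Binary.Core using (Rel)
open import Relation.Binary.Definitions using (Trichotomous; tri<; tri≈; tri>)
open import Relation.Binary.Structures using (IsStrictTotalOrder)
open import Relation.Binary.Structures.Biased using (isStrictTotalOrderᶜ)
open import Relation.Binary.Construct.Closure.Transitive
  using (TransClosure; [_]; _∷_; _∷ʳ_; _++_)
open import Relation.Binary.PropositionalEquality
  using (_≡_; _≢_; refl; sym; trans; cong; cong₂; subst; subst₂; isEquivalence)

-- `WellPlaced` mediates between the two sides: it describes the stubs by the order relative to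
-- E(G), follows from the axioms in every CPP-extension, holds in the constructed graph by design,
-- and suffices to carry upward planarity from G to Γ and back.
--
-- Why `tight` is forced: an edge y between the stub x into v and o = min O(v) would, by P₂, be
-- reached from x, hence through an edge of O(v) below o, or would reach o, hence through x, the
-- only edge into v. Why the start is innermost: if a pair in O(u) encloses the stub, an edge into u
-- reaches it by P₂, so it does not start at a source; and if m is the last edge of G before the
-- stub in its own family, a pair (c , d) of another family around the stub with m ≺ c would cross:
-- m ≺ c ≺ x ≺ d.
--
-- The obstacle in the converse is that an attached stub joins O(u) and might create a crossing
-- there. It does not, because every other family around the stub opens before the last edge of G in
-- O(u) below it, and the stub can be exchanged for that edge.
--
-- E₂ enters only as a count: E(G) and the stubs already inject into E(Γ).

module _ {A : Set} where

  flip-sto : {_≺_ : Rel A 0ℓ} → IsStrictTotalOrder _≡_ _≺_ → IsStrictTotalOrder _≡_ (flip _≺_)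
  flip-sto sto = isStrictTotalOrderᶜ record
    { isEquivalence = isEquivalence
    ; trans         = flip (IsStrictTotalOrder.trans sto)
    ; compare       = compare
    }
    where
    compare : Trichotomous _≡_ _
    compare x y with IsStrictTotalOrder.compare sto x y
    ... | tri< a b c = tri> c b a
    ... | tri≈ a b c = tri≈ c b a
    ... | tri> a b c = tri< c b a

  on-sto : {B : Set} {_≺_ : Rel B 0ℓ} {f : A → B} → Injective _≡_ _≡_ f →
           IsStrictTotalOrder _≡_ _≺_ → IsStrictTotalOrder _≡_ (_≺_ on f)
  on-sto {f = f} inj sto = isStrictTotalOrderᶜ record
    { isEquivalence = isEquivalence
    ; trans         = IsStrictTotalOrder.trans sto
    ; compare       = compare
    }
    where
    compare : Trichotomous _≡_ _
    compare x y with IsStrictTotalOrder.compare sto (f x) (f y)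
    ... | tri< a b c = tri< a (b ∘ cong f) c
    ... | tri≈ a b c = tri≈ a (inj b) c
    ... | tri> a b c = tri> a (b ∘ cong f) c

-- Extremes and intervals in finite linear orders

module StrictOrder {A : Set} {_≺_ : Rel A 0ℓ} (sto : IsStrictTotalOrder _≡_ _≺_) where
  open IsStrictTotalOrder sto public using (compare; _<?_; asym) renaming (trans to ≺-trans)
  open Order _≺_ public

  ≺-irrefl : ∀ {x} → ¬ (x ≺ x)
  ≺-irrefl = IsStrictTotalOrder.irrefl sto refl

  ≺⇒≢ : ∀ {x y} → x ≺ y → x ≢ y
  ≺⇒≢ x≺y refl = ≺-irrefl x≺y

  ≼-≺-trans : ∀ {x y z} → x ≼ y → y ≺ z → x ≺ z
  ≼-≺-trans (inj₁ x≺y) y≺z = ≺-trans x≺y y≺z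
  ≼-≺-trans (inj₂ refl) y≺z = y≺z

  ≺-≼-trans : ∀ {x y z} → x ≺ y → y ≼ z → x ≺ z
  ≺-≼-trans x≺y (inj₁ y≺z) = ≺-trans x≺y y≺z
  ≺-≼-trans x≺y (inj₂ refl) = x≺y

  ≼-trans : ∀ {x y z} → x ≼ y → y ≼ z → x ≼ z
  ≼-trans (inj₁ x≺y) y≼z = inj₁ (≺-≼-trans x≺y y≼z)
  ≼-trans (inj₂ refl) y≼z = y≼z

  ≼-antisym : ∀ {x y} → x ≼ y → y ≼ x → x ≡ y
  ≼-antisym (inj₁ x≺y) y≼x = ⊥-elim (≺-irrefl (≺-≼-trans x≺y y≼x))
  ≼-antisym (inj₂ eq)  _   = eq

  ≼⇒⊁ : ∀ {x y} → x ≼ y → ¬ (y ≺ x)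
  ≼⇒⊁ x≼y y≺x = ≺-irrefl (≼-≺-trans x≼y y≺x)

  ⊁⇒≼ : ∀ {x y} → ¬ (y ≺ x) → x ≼ y
  ⊁⇒≼ {x} {y} ⊁ with compare x y
  ... | tri< lt _ _ = inj₁ lt
  ... | tri≈ _ eq _ = inj₂ eq
  ... | tri> _ _ gt = ⊥-elim (⊁ gt)

  ≺-or-≽ : ∀ x y → x ≺ y ⊎ y ≼ x
  ≺-or-≽ x y with x <? y
  ... | yes lt = inj₁ lt
  ... | no ≮   = inj₂ (⊁⇒≼ ≮)

  ≼∧≢⇒≺ : ∀ {x y} → x ≼ y → x ≢ y → x ≺ y
  ≼∧≢⇒≺ (inj₁ x≺y) _ = x≺y
  ≼∧≢⇒≺ (inj₂ eq) ne = ⊥-elim (ne eq)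

module _ {n} {_≺_ : Rel (Fin n) 0ℓ} (sto : IsStrictTotalOrder _≡_ _≺_) where
  open StrictOrder sto

  ≺-max : ∀ {P : Pred (Fin n) 0ℓ} → Decidable P → ∃ P → ∃ (IsMax P)
  ≺-max {P} P? (x , px) = go px (spo-noetherian (IsStrictTotalOrder.isStrictPartialOrder sto) x)
    where
    go : ∀ {x} → P x → Acc (flip _≺_) x → ∃ (IsMax P)
    go {x} px (acc above) with any? (λ y → P? y ×-dec (x <? y))
    ... | yes (y , py , x≺y) = go py (above x≺y)
    ... | no none = x , px , λ {y} py → ⊁⇒≼ (λ x≺y → none (y , py , x≺y))

flip-IsMax : ∀ {A : Set} {_≺_ : Rel A 0ℓ} {P : Pred A 0ℓ} {a} →
             Order.IsMax (flip _≺_) P a → Order.IsMin _≺_ P a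
flip-IsMax (pa , max) = pa , [ inj₁ , inj₂ ∘ sym ]′ ∘ max

≺-min : ∀ {n} {_≺_ : Rel (Fin n) 0ℓ} → IsStrictTotalOrder _≡_ _≺_ →
        ∀ {P : Pred (Fin n) 0ℓ} → Decidable P → ∃ P → ∃ (Order.IsMin _≺_ P)
≺-min {_≺_ = _≺_} sto P? p with ≺-max (flip-sto sto) P? p
... | a , max = a , flip-IsMax {_≺_ = _≺_} max

module _ {n} {_≺_ : Rel (Fin n) 0ℓ} (sto : IsStrictTotalOrder _≡_ _≺_)
         {P : Pred (Fin n) 0ℓ} (P? : Decidable P) where
  open StrictOrder sto

  between⇒Hull : ∀ {p y q} → P p → P q → p ≼ y → y ≼ q → Hull P y
  between⇒Hull {p} pp pq p≼y y≼q with ≺-min sto P? (p , pp) | ≺-max sto P? (p , pp)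
  ... | a , mina | b , maxb =
    a , b , mina , maxb , ≼-trans (proj₂ mina pp) p≼y , ≼-trans y≼q (proj₂ maxb pq)

  between⇒StrictlyInside : ∀ {p y q} → P p → P q → p ≺ y → y ≺ q → StrictlyInside P y
  between⇒StrictlyInside {p} pp pq p≺y y≺q with ≺-min sto P? (p , pp) | ≺-max sto P? (p , pp)
  ... | a , mina | b , maxb =
    a , b , mina , maxb , ≼-≺-trans (proj₂ mina pp) p≺y , ≺-≼-trans y≺q (proj₂ maxb pq)

-- Enumeration and counting of decidable subsets

lookup-injective : ∀ {A : Set} {xs : List A} → Unique xs → Injective _≡_ _≡_ (lookup xs)
lookup-injective (_ ∷ u) {zero}  {zero}  eq = refl
lookup-injective {xs = _ List.∷ xs} (a ∷ _) {zero} {suc j} eq = ⊥-elim (All.lookup a (∈-lookup j) eq)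
lookup-injective {xs = _ List.∷ xs} (a ∷ _) {suc i} {zero} eq = ⊥-elim (All.lookup a (∈-lookup i) (sym eq))
lookup-injective (_ ∷ u) {suc i} {suc j} eq = cong suc (lookup-injective u eq)

module Enumeration {n} {P : Pred (Fin n) 0ℓ} (P? : Decidable P) where

  elem : Fin (card P?) → Fin n
  elem = lookup (filter P? (allFin n))

  elem-∈ : ∀ i → P (elem i)
  elem-∈ i = proj₂ (∈-filter⁻ P? {xs = allFin n} (∈-lookup i))

  elem-injective : Injective _≡_ _≡_ elem
  elem-injective = lookup-injective (filter⁺ P? (allFin⁺ n))

  position : ∀ {x} → P x → Fin (card P?)
  position {x} px = index (∈-filter⁺ P? (∈-allFin x) px)

  elem-position : ∀ {x} (px : P x) → elem (position px) ≡ x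
  elem-position {x} px = sym (lookup-index (∈-filter⁺ P? (∈-allFin x) px))

module _ {n} {P : Pred (Fin n) 0ℓ} (P? : Decidable P) where
  open Enumeration P?

  card≡0 : (∀ x → ¬ P x) → card P? ≡ 0
  card≡0 none with card P? | elem | elem-∈
  ... | zero  | _ | _ = refl
  ... | suc _ | e | e∈ = ⊥-elim (none (e zero) (e∈ zero))

  card≡1 : ∀ {x} → P x → (∀ {y z} → P y → P z → y ≡ z) → card P? ≡ 1
  card≡1 px unique with card P? | elem | elem-∈ | (λ {i} {j} → elem-injective {i} {j}) | position px
  ... | suc zero    | _ | _  | _   | _ = refl
  ... | suc (suc _) | e | e∈ | inj | _ with inj (unique (e∈ zero) (e∈ (suc zero)))
  ... | ()

  card≡1⇒unique : card P? ≡ 1 → ∀ {y z} → P y → P z → y ≡ z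
  card≡1⇒unique eq py pz =
    trans (sym (elem-position py)) (trans (cong elem (Fin1 eq _ _)) (elem-position pz))
    where
    Fin1 : ∀ {m} → m ≡ 1 → (i j : Fin m) → i ≡ j
    Fin1 refl zero zero = refl

  card≡1⇒∃ : card P? ≡ 1 → ∃ P
  card≡1⇒∃ eq = elem i , elem-∈ i
    where
    i : Fin (card P?)
    i = subst Fin (sym eq) zero

-- A missed value could be punched out of the codomain, leaving an injection into a smaller set.
injective⇒surjective : ∀ {m n} {f : Fin m → Fin n} → n ≡ m → Injective _≡_ _≡_ f → ∀ y → ∃[ x ] f x ≡ y
injective⇒surjective {zero}  {f = f} refl inj ()
injective⇒surjective {suc m} {f = f} refl inj y with any? (λ x → f x ≟ y)
... | yes p = p
... | no ¬p = ⊥-elim (ℕ.1+n≰n (injective⇒≤ (λ {x} {x′} eq →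
                inj (punchOut-injective (avoids x) (avoids x′) eq))))
  where
  avoids : ∀ x → y ≢ f x
  avoids x eq = ¬p (x , sym eq)

op : Digraph → Digraph
op G = record { #V = #V ; #E = #E ; s = t ; t = s }
  where open Digraph G

-- Upward planar orders without hulls

-- The fibres of f form a noncrossing partition in the usual sense. Those of `t` are the sets I(v),
-- those of `s` the sets O(v).
NonCrossing : {A B : Set} → Rel A 0ℓ → (A → B) → Set
NonCrossing _≺_ f = ∀ {a b c d} → f a ≡ f c → f b ≡ f d → a ≺ b → b ≺ c → c ≺ d → f a ≡ f b

flip-noncrossing : ∀ {A B : Set} {_≺_ : Rel A 0ℓ} {f : A → B} → NonCrossing _≺_ f → NonCrossing (flip _≺_) f
flip-noncrossing nc p q ab bc cd = trans p (trans (sym (nc (sym q) (sym p) cd bc ab)) (sym q))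

-- The conclusions of gap are negated so that the record is definitionally
-- self-dual under op and flip.
record IsUpward (G : Digraph) (_≺_ : Rel (Digraph.E G) 0ℓ) : Set where
  open Digraph G
  field
    flow   : ∀ {e f} → t e ≡ s f → e ≺ f
    gap    : ∀ {i y o} → t i ≡ s o → i ≺ y → y ≺ o →
             (∃[ i′ ] t i′ ≡ t i × ¬ (i′ ≺ y)) ⊎ (∃[ o′ ] s o′ ≡ s o × ¬ (y ≺ o′))
    nc-in  : NonCrossing _≺_ t
    nc-out : NonCrossing _≺_ s

module _ {G : Digraph} {_≺_ : Rel (Digraph.E G) 0ℓ} where

  op-upward : IsUpward G _≺_ → IsUpward (op G) (flip _≺_)
  op-upward up = record
    { flow   = λ eq → flow (sym eq)
    ; gap    = λ eq i≻y y≻o → swap (gap (sym eq) y≻o i≻y)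
    ; nc-in  = flip-noncrossing {f = s} nc-out
    ; nc-out = flip-noncrossing {f = t} nc-in
    }
    where
    open IsUpward up
    open Digraph G

  module Walks (flow : ∀ {e f} → Digraph.t G e ≡ Digraph.s G f → e ≺ f)
               (≺-trans : ∀ {e f g} → e ≺ f → f ≺ g → e ≺ g) where
    open Graph G
    open Order _≺_

    walk⇒≺ : ∀ {e f} → TransClosure Consecutive e f → e ≺ f
    walk⇒≺ [ eq ]   = flow eq
    walk⇒≺ (eq ∷ w) = ≺-trans (flow eq) (walk⇒≺ w)

    first-step : ∀ {e f} → TransClosure Consecutive e f → ∃[ o ] s o ≡ t e × o ≼ f
    first-step [ eq ]   = _ , sym eq , inj₂ refl
    first-step (eq ∷ w) = _ , sym eq , inj₁ (walk⇒≺ w)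

    last-step : ∀ {e f} → TransClosure Consecutive e f →
                ∃[ i ] t i ≡ s f × (e ≡ i ⊎ TransClosure Consecutive e i)
    last-step [ eq ]   = _ , eq , inj₁ refl
    last-step (eq ∷ w) with last-step w
    ... | i , ti , inj₁ refl = i , ti , inj₂ [ eq ]
    ... | i , ti , inj₂ w′   = i , ti , inj₂ (eq ∷ w′)

reverse : ∀ {G e f} → TransClosure (Graph.Consecutive G) e f → TransClosure (Graph.Consecutive (op G)) f e
reverse [ eq ]   = [ sym eq ]
reverse (eq ∷ w) = reverse w ∷ʳ sym eq

upward-resp : ∀ {G} {_≺_ _≺′_ : Rel (Digraph.E G) 0ℓ} → (∀ e f → e ≺ f ⇔ e ≺′ f) →
              IsUpward G _≺_ → IsUpward G _≺′_
upward-resp {_≺_ = _≺_} {_≺′_} iff up = record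
  { flow   = λ eq → ⇒ (flow eq)
  ; gap    = λ eq i≺y y≺o → [ (λ (i′ , eq′ , i′⊀y) → inj₁ (i′ , eq′ , i′⊀y ∘ ⇐))
                            , (λ (o′ , eq′ , y⊀o′) → inj₂ (o′ , eq′ , y⊀o′ ∘ ⇐)) ]′
                            (gap eq (⇐ i≺y) (⇐ y≺o))
  ; nc-in  = λ p q ab bc cd → nc-in p q (⇐ ab) (⇐ bc) (⇐ cd)
  ; nc-out = λ p q ab bc cd → nc-out p q (⇐ ab) (⇐ bc) (⇐ cd)
  }
  where
  open IsUpward up
  ⇒ : ∀ {e f} → e ≺ f → e ≺′ f
  ⇒ = Equivalence.to (iff _ _)
  ⇐ : ∀ {e f} → e ≺′ f → e ≺ f
  ⇐ = Equivalence.from (iff _ _)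

module _ {n m} {_≺_ : Rel (Fin n) 0ℓ} (sto : IsStrictTotalOrder _≡_ _≺_) (f : Fin n → Fin m) where
  open StrictOrder sto

  private
    Fibre : Fin m → Pred (Fin n) 0ℓ
    Fibre v e = f e ≡ v

    fibre? : ∀ v → Decidable (Fibre v)
    fibre? v e = f e ≟ v

    HullAbsorbing : Set
    HullAbsorbing = ∀ v₁ v₂ → Fibre v₁ ≬ Hull (Fibre v₂) → Hull (Fibre v₁) ⊆ Hull (Fibre v₂)

  -- Of two crossing fibres each meets the hull of the other, so the hulls absorb each other and
  -- have the same least element. That element lies in both fibres.
  absorbing⇒noncrossing : HullAbsorbing → NonCrossing _≺_ f
  absorbing⇒noncrossing absorb {a} {b} {c} {d} fa≡fc fb≡fd a≺b b≺c c≺d =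
    trans (sym (proj₁ (proj₂ min-a)))
      (trans (cong f (≼-antisym (least (f b) (f a) b b-in refl min-a min-b)
                                (least (f a) (f b) c c-in (sym fa≡fc) min-b min-a)))
             (proj₁ (proj₂ min-b)))
    where
    b-in : Hull (Fibre (f a)) b
    b-in = between⇒Hull sto (fibre? (f a)) refl (sym fa≡fc) (inj₁ a≺b) (inj₁ b≺c)
    c-in : Hull (Fibre (f b)) c
    c-in = between⇒Hull sto (fibre? (f b)) refl (sym fb≡fd) (inj₁ b≺c) (inj₁ c≺d)
    min-a : ∃ (IsMin (Fibre (f a)))
    min-a = ≺-min sto (fibre? (f a)) (a , refl)
    min-b : ∃ (IsMin (Fibre (f b)))
    min-b = ≺-min sto (fibre? (f b)) (b , refl)
    least : ∀ v w y → Hull (Fibre w) y → Fibre v y → ((m , _) : ∃ (IsMin (Fibre w))) →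
            ((n , _) : ∃ (IsMin (Fibre v))) → m ≼ n
    least v w y y-in fy (m , _ , m-least) (n , fn , _)
      with absorb v w (y , fy , y-in) (between⇒Hull sto (fibre? v) fn fn (inj₂ refl) (inj₂ refl))
    ... | p , _ , (fp , _) , _ , p≼n , _ = ≼-trans (m-least fp) p≼n

  -- Let e in the first fibre lie between the extremes a, b of the second. An extreme of the first
  -- fibre outside [a , b] would complete a crossing with a, e, b and make the fibres equal;
  -- otherwise the whole first hull lies in [a , b].
  noncrossing⇒absorbing : NonCrossing _≺_ f → HullAbsorbing
  noncrossing⇒absorbing nc v₁ v₂ (e , fe , a , b , (fa , _) , (fb , _) , a≼e , e≼b)
                                 (c , d , (fc , _) , (fd , _) , c≼z , z≼d) = absorb a≼e e≼b
    where
    same : v₁ ≡ v₂ → Hull (Fibre v₂) _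
    same refl = between⇒Hull sto (fibre? v₂) fc fd c≼z z≼d
    absorb : a ≼ e → e ≼ b → Hull (Fibre v₂) _
    absorb (inj₂ refl) _           = same (trans (sym fe) fa)
    absorb (inj₁ _)    (inj₂ refl) = same (trans (sym fe) fb)
    absorb (inj₁ a≺e)  (inj₁ e≺b) with ≺-or-≽ c a | ≺-or-≽ b d
    ... | inj₁ c≺a | _ =
      same (trans (sym fc) (trans (nc (trans fc (sym fe)) (trans fa (sym fb)) c≺a a≺e e≺b) fa))
    ... | _ | inj₁ b≺d =
      same (trans (sym fe) (trans (sym (nc (trans fa (sym fb)) (trans fe (sym fd)) a≺e e≺b b≺d)) fa))
    ... | inj₂ a≼c | inj₂ d≼b = between⇒Hull sto (fibre? v₂) fa fb (≼-trans a≼c c≼z) (≼-trans z≼d d≼b)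

module _ {G : Digraph} where
  open Graph G

  inc? : ∀ v → Decidable (Inc v)
  inc? v e = in? v e ⊎-dec out? v e

  upward : Acyclic → (P : UpwardPlanarOrder G) → IsUpward G (UpwardPlanarOrder._≺_ P)
  upward acyclic P = record
    { flow   = λ {e} eq → U₁ ((λ { refl → acyclic e [ eq ] }) , [ eq ])
    ; gap    = gap
    ; nc-in  = absorbing⇒noncrossing isStrictTotalOrder t U₃-in
    ; nc-out = absorbing⇒noncrossing isStrictTotalOrder s U₃-out
    }
    where
    open UpwardPlanarOrder P
    module O = StrictOrder isStrictTotalOrder
    -- By U₂ the edge y lies in the hull of I(v) or of O(v); the witness is I(v)⁺ or O(v)⁻
    -- accordingly.
    gap : ∀ {i y o} → t i ≡ s o → i ≺ y → y ≺ o →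
          (∃[ i′ ] t i′ ≡ t i × ¬ (i′ ≺ y)) ⊎ (∃[ o′ ] s o′ ≡ s o × ¬ (y ≺ o′))
    gap {i} {y} {o} eq i≺y y≺o
      with proj₁ (U₂-union (t i)) (between⇒Hull isStrictTotalOrder (inc? (t i))
             (inj₁ refl) (inj₂ (sym eq)) (inj₁ i≺y) (inj₁ y≺o))
    ... | inj₁ (_ , b , _ , (tb , _) , _ , y≼b) = inj₁ (b , tb , O.≼⇒⊁ y≼b)
    ... | inj₂ (a , _ , (sa , _) , _ , a≼y , _) = inj₂ (a , trans sa eq , O.≼⇒⊁ a≼y)

  upwardPlanarOrder : ∀ {_≺_ : Rel E 0ℓ} → IsStrictTotalOrder _≡_ _≺_ → IsUpward G _≺_ → UpwardPlanarOrder G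
  upwardPlanarOrder {_≺_} sto up = record
    { _≺_                = _≺_
    ; isStrictTotalOrder = sto
    ; U₁          = λ (_ , walk) → Walks.walk⇒≺ flow ≺-trans walk
    -- A common point y gives q ≼ y ≼ p with p incoming and q outgoing, against p ≺ q.
    ; U₂-disjoint = λ { v (y , (_ , p , _ , (tp , _) , _ , y≼p) , (q , _ , (sq , _) , _ , q≼y , _)) →
                        ≼⇒⊁ (≼-trans q≼y y≼p) (flow (trans tp (sym sq))) }
    ; U₂-union    = λ v → union v , [ widen inj₁ , widen inj₂ ]′
    ; U₃-in       = noncrossing⇒absorbing sto t nc-in
    ; U₃-out      = noncrossing⇒absorbing sto s nc-out
    }
    where
    open IsUpward up
    open StrictOrder sto

    widen : ∀ {v} {P : Pred E 0ℓ} → P ⊆ Inc v → Hull P ⊆ Hull (Inc v)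
    widen P⊆ (a , b , (pa , _) , (pb , _) , a≼y , y≼b) = between⇒Hull sto (inc? _) (P⊆ pa) (P⊆ pb) a≼y y≼b

    -- Each extreme of E(v) is incoming or outgoing. Extremes of the same kind are immediate, an
    -- outgoing minimum with an incoming maximum contradicts `flow`, and the remaining mixed case is
    -- what `gap` was made for.
    union : ∀ v → Hull (Inc v) ⊆ Hull (In v) ∪ Hull (Out v)
    union v (a , b , (inj₁ ta , _) , (inj₁ tb , _) , a≼y , y≼b) =
      inj₁ (between⇒Hull sto (in? v) ta tb a≼y y≼b)
    union v (a , b , (inj₂ sa , _) , (inj₂ sb , _) , a≼y , y≼b) =
      inj₂ (between⇒Hull sto (out? v) sa sb a≼y y≼b)
    union v (a , b , (inj₂ sa , _) , (inj₁ tb , _) , a≼y , y≼b) =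
      ⊥-elim (≼⇒⊁ (≼-trans a≼y y≼b) (flow (trans tb (sym sa))))
    union v (a , b , (inj₁ ta , _) , (inj₂ sb , _) , inj₂ refl , y≼b) =
      inj₁ (between⇒Hull sto (in? v) ta ta (inj₂ refl) (inj₂ refl))
    union v (a , b , (inj₁ ta , _) , (inj₂ sb , _) , inj₁ a≺y , inj₂ refl) =
      inj₂ (between⇒Hull sto (out? v) sb sb (inj₂ refl) (inj₂ refl))
    union v (a , b , (inj₁ ta , _) , (inj₂ sb , _) , inj₁ a≺y , inj₁ y≺b)
      with gap (trans ta (sym sb)) a≺y y≺b
    ... | inj₁ (i , ti , i⊀y) = inj₁ (between⇒Hull sto (in? v) ta (trans ti ta) (inj₁ a≺y) (⊁⇒≼ i⊀y))
    ... | inj₂ (o , so , y⊀o) = inj₂ (between⇒Hull sto (out? v) (trans so sb) sb (⊁⇒≼ y⊀o) (inj₁ y≺b))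

-- Upward planarity and P₂

-- P₂ for bare walks, which allows induction on them. The inequalities contained in `⇝` are supplied
-- by e ≺ y ≺ f.
Planar : (G : Digraph) → Rel (Digraph.E G) 0ℓ → Set
Planar G _≺_ = ∀ {e y f} → TransClosure Consecutive e f → e ≺ y → y ≺ f →
               TransClosure Consecutive e y ⊎ TransClosure Consecutive y f
  where open Graph G

op-planar : ∀ {G} {_≺_ : Rel (Digraph.E G) 0ℓ} → Planar G _≺_ → Planar (op G) (flip _≺_)
op-planar planar w y≺e f≺y =
  swap ([ inj₁ ∘ reverse , inj₂ ∘ reverse ]′ (planar (reverse w) f≺y y≺e))

module _ {G : Digraph} {_≺_ : Rel (Digraph.E G) 0ℓ} (sto : IsStrictTotalOrder _≡_ _≺_)
         (flow : ∀ {e f} → Digraph.t G e ≡ Digraph.s G f → e ≺ f) where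
  open Graph G
  open StrictOrder sto
  open Walks {G} flow ≺-trans

  private
    _→⁺_ : Rel E 0ℓ
    _→⁺_ = TransClosure Consecutive

  module _ (planar : Planar G _≺_) where

    -- P₂ applies to the step from i to b. A walk from x to b would enter the common vertex by an
    -- edge not before x, and that edge precedes a by `flow`, against a ≺ x.
    planar⇒reachable : ∀ {i a x b} → t i ≡ s a → s a ≡ s b → a ≺ x → x ≺ b → i →⁺ x
    planar⇒reachable ti sab a≺x x≺b
      with planar [ trans ti sab ] (≺-trans (flow ti) a≺x) x≺b
    ... | inj₁ walk = walk
    ... | inj₂ walk with last-step walk
    ... | _ , tk , inj₁ refl  = ⊥-elim (asym a≺x (flow (trans tk (sym sab))))
    ... | _ , tk , inj₂ walk′ =
      ⊥-elim (asym a≺x (≺-trans (walk⇒≺ walk′) (flow (trans tk (sym sab)))))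

    -- P₂ applies to the step from i to o: a walk from i to y leaves the vertex by the outgoing
    -- witness, a walk from y to o enters it by the incoming one.
    planar⇒gap : ∀ {i y o} → t i ≡ s o → i ≺ y → y ≺ o →
                 (∃[ i′ ] t i′ ≡ t i × ¬ (i′ ≺ y)) ⊎ (∃[ o′ ] s o′ ≡ s o × ¬ (y ≺ o′))
    planar⇒gap eq i≺y y≺o with planar [ eq ] i≺y y≺o
    ... | inj₁ walk = let o′ , so′ , o′≼y = first-step walk in inj₂ (o′ , trans so′ eq , ≼⇒⊁ o′≼y)
    ... | inj₂ walk with last-step walk
    ... | i′ , ti′ , inj₁ refl  = inj₁ (i′ , trans ti′ (sym eq) , ≺-irrefl)
    ... | i′ , ti′ , inj₂ walk′ = inj₁ (i′ , trans ti′ (sym eq) , asym (walk⇒≺ walk′))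

    -- Two crossing families of outgoing edges would make each of their
    -- starting vertices reachable from the other.
    planar⇒nc-out : (∀ {a b} → s a ≡ s b → a ≺ b → ∃[ i ] t i ≡ s a) → NonCrossing _≺_ s
    planar⇒nc-out incoming {a} {b} {c} {d} sac sbd a≺b b≺c c≺d
      with incoming sac (≺-trans a≺b b≺c)
    ... | i , ti with last-step (planar⇒reachable ti sac a≺b b≺c)
    ... | k , tk , inj₁ refl = trans (sym ti) tk
    ... | k , tk , inj₂ i→k with first-step i→k | last-step (planar⇒reachable tk sbd b≺c c≺d)
    ... | o , so , o≼k | j , tj , k→j =
      ⊥-elim (≺-irrefl (≺-≼-trans (≼-≺-trans k≼j j≺o) o≼k))
      where
      j≺o : j ≺ o
      j≺o = flow (trans tj (trans (sym sac) (trans (sym ti) (sym so))))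
      k≼j : k ≼ j
      k≼j = [ inj₂ , inj₁ ∘ walk⇒≺ ]′ k→j

  module _ (up : IsUpward G _≺_)
           (incoming : ∀ {a y b} → s a ≡ s b → a ≺ y → y ≺ b → ∃[ i ] t i ≡ s y) where
    open IsUpward up using (gap; nc-out)

    -- Climb from y to an edge ending at s y: by gap and noncrossing it can be
    -- chosen not to leave the interval above a.
    upward⇒reachable : ∀ {i a y b} → t i ≡ s a → s a ≡ s b → a ≺ y → y ≺ b → i →⁺ y
    upward⇒reachable {i} {a} {y} {b} ti sab = go (spo-wellFounded (IsStrictTotalOrder.isStrictPartialOrder sto) y)
      where
      go : ∀ {y} → Acc _≺_ y → a ≺ y → y ≺ b → i →⁺ y

      go {y} (acc below) a≺y y≺b with s a ≟ s y
      ... | yes eq = [ trans ti eq ]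
      ... | no ne  = via (incoming sab a≺y y≺b)
        where
        through : ∀ {k} → t k ≡ s y → a ≼ k → i →⁺ y
        through tk (inj₂ refl) = ti ∷ [ tk ]
        through tk (inj₁ a≺k)  = go (below (flow tk)) a≺k (≺-trans (flow tk) y≺b) ∷ʳ tk

        via : ∃[ k ] t k ≡ s y → i →⁺ y
        via (k , tk) with ≺-or-≽ k a
        ... | inj₂ a≼k = through tk a≼k
        ... | inj₁ k≺a with gap tk k≺a a≺y
        ... | inj₁ (k′ , tk′ , k′⊀a) = through (trans tk′ tk) (⊁⇒≼ k′⊀a)
        ... | inj₂ (o , so , a⊀o) =
          ⊥-elim (ne (sym (trans (sym so) (nc-out so sab (≼∧≢⇒≺ (⊁⇒≼ a⊀o) λ { refl → ne so }) a≺y y≺b))))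

module _ {G : Digraph} {_≺_ : Rel (Digraph.E G) 0ℓ} (sto : IsStrictTotalOrder _≡_ _≺_) where
  open Graph G
  open StrictOrder sto

  -- The last two hypotheses are the trace of processivity: a vertex with two edges on one side has
  -- an edge on the other.
  planar⇒upward : (∀ {e f} → t e ≡ s f → e ≺ f) → Planar G _≺_ →
                  (∀ {a b} → s a ≡ s b → a ≺ b → ∃[ i ] t i ≡ s a) →
                  (∀ {a b} → t a ≡ t b → b ≺ a → ∃[ o ] s o ≡ t a) →
                  IsUpward G _≺_
  planar⇒upward flow planar incoming outgoing = record
    { flow   = flow
    ; gap    = planar⇒gap sto flow planar
    ; nc-in  = flip-noncrossing {f = t} (planar⇒nc-out {op G} (flip-sto sto) (λ eq → flow (sym eq))
                                          (op-planar {G} planar) outgoing)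
    ; nc-out = planar⇒nc-out sto flow planar incoming
    }

  upward⇒planar : IsUpward G _≺_ →
                  (∀ {a y b} → s a ≡ s b → a ≺ y → y ≺ b → ∃[ i ] t i ≡ s y) →
                  (∀ {a y b} → t a ≡ t b → y ≺ a → b ≺ y → ∃[ o ] s o ≡ t y) →
                  Planar G _≺_
  upward⇒planar up incoming outgoing = planar
    where
    open IsUpward up

    _→⁺_ : Rel E 0ℓ
    _→⁺_ = TransClosure Consecutive

    -- The witness of `gap` encloses y together with o, or together with i, unless it is y itself;
    -- then `upward⇒reachable` or its dual gives the walk.
    edge : ∀ {i y o} → t i ≡ s o → i ≺ y → y ≺ o → i →⁺ y ⊎ y →⁺ o
    edge {i} {y} {o} eq i≺y y≺o with gap eq i≺y y≺o
    ... | inj₂ (o′ , so′ , y⊀o′) with ⊁⇒≼ y⊀o′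
    ...   | inj₁ o′≺y = inj₁ (upward⇒reachable sto flow up incoming (trans eq (sym so′)) so′ o′≺y y≺o)
    ...   | inj₂ refl = inj₁ [ trans eq (sym so′) ]
    edge {i} {y} {o} eq i≺y y≺o | inj₁ (i′ , ti′ , i′⊀y) with ⊁⇒≼ i′⊀y
    ...   | inj₁ y≺i′ = inj₂ (reverse {op G} (upward⇒reachable {op G} (flip-sto sto) (λ e → flow (sym e))
                          (op-upward up) outgoing (trans (sym eq) (sym ti′)) ti′ y≺i′ i≺y))
    ...   | inj₂ refl = inj₂ [ trans ti′ eq ]

    planar : Planar G _≺_
    planar [ eq ] e≺y y≺f = edge eq e≺y y≺f
    planar {y = y} (_∷_ {y = g} eq w) e≺y y≺f with compare y g
    ... | tri< y≺g _ _  = [ inj₁ , (λ v → inj₂ (v ++ w)) ]′ (edge eq e≺y y≺g)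
    ... | tri≈ _ refl _ = inj₁ [ eq ]
    ... | tri> _ _ g≺y  = [ (λ v → inj₁ (eq ∷ v)) , inj₂ ]′ (planar w g≺y y≺f)

op-embedding : ∀ {G H} → Embedding G H → Embedding (op G) (op H)
op-embedding φ = record
  { φ₀ = φ₀ ; φ₁ = φ₁ ; φ₀-injective = φ₀-injective ; φ₁-injective = φ₁-injective ; s-φ = t-φ ; t-φ = s-φ }
  where open Embedding φ

-- Extensions by stubs

-- The shape of a CPP-extension as a graph, with the count E₂ replaced by what it entails: every
-- edge is old or a stub, and stubs are unique. Nothing ties the order to the graph, so a
-- constructed graph qualifies before its order is known to be planar.
record Skeleton (G : Digraph) : Set₁ where
  private module G = Graph G
  field
    Γ         : Digraph
    _≺_       : Rel (Digraph.E Γ) 0ℓ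
    sto       : IsStrictTotalOrder _≡_ _≺_
    embedding : Embedding G Γ
  open Embedding embedding public
  private module Γ = Graph Γ

  InStub : Pred Γ.E 0ℓ
  InStub x = ∃[ v ] v ∈ G.Source × Γ.t x ≡ φ₀ v

  OutStub : Pred Γ.E 0ℓ
  OutStub x = ∃[ v ] v ∈ G.Sink × Γ.s x ≡ φ₀ v

  field
    inner-in      : ∀ v → ∃[ x ] Γ.t x ≡ φ₀ v
    inner-out     : ∀ v → ∃[ x ] Γ.s x ≡ φ₀ v
    vertex        : ∀ z → Image φ₀ z ⊎ z ∈ Γ.Source ⊎ z ∈ Γ.Sink
    source-out    : ∀ {z} → z ∈ Γ.Source → ∃[ x ] Γ.s x ≡ z
    sink-in       : ∀ {z} → z ∈ Γ.Sink → ∃[ x ] Γ.t x ≡ z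
    source-unique : ∀ {z x y} → z ∈ Γ.Source → Γ.s x ≡ z → Γ.s y ≡ z → x ≡ y
    sink-unique   : ∀ {z x y} → z ∈ Γ.Sink → Γ.t x ≡ z → Γ.t y ≡ z → x ≡ y
    edge          : ∀ x → Image φ₁ x ⊎ InStub x ⊎ OutStub x
    in-unique     : ∀ {v x y} → v ∈ G.Source → Γ.t x ≡ φ₀ v → Γ.t y ≡ φ₀ v → x ≡ y
    out-unique    : ∀ {v x y} → v ∈ G.Sink → Γ.s x ≡ φ₀ v → Γ.s y ≡ φ₀ v → x ≡ y
    disjoint      : ∀ {x} → InStub x → OutStub x → ⊥

  open Digraph Γ public using (s; t)

op-skeleton : ∀ {G} → Skeleton G → Skeleton (op G)
op-skeleton S = record
  { Γ             = op Γ
  ; _≺_           = flip _≺_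
  ; sto           = flip-sto sto
  ; embedding     = op-embedding embedding
  ; inner-in      = inner-out
  ; inner-out     = inner-in
  ; vertex        = λ z → [ inj₁ , inj₂ ∘ swap ]′ (vertex z)
  ; source-out    = sink-in
  ; sink-in       = source-out
  ; source-unique = sink-unique
  ; sink-unique   = source-unique
  ; edge          = λ x → [ inj₁ , inj₂ ∘ swap ]′ (edge x)
  ; in-unique     = out-unique
  ; out-unique    = in-unique
  ; disjoint      = flip disjoint
  }
  where open Skeleton S

-- Placement of stubs

module _ (G Γ : Digraph) (_≺_ : Rel (Digraph.E Γ) 0ℓ) (φ : Embedding G Γ) where
  private
    module G = Graph G
    module Γ = Graph Γ
  open Embedding φ

  -- Only edges of G count as ends of an enclosing pair, which makes enclosure comparable between
  -- different extensions of G.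
  Encloses : G.E → G.E → Pred Γ.E 0ℓ
  Encloses c d x = G.s c ≡ G.s d × φ₁ c ≺ x × x ≺ φ₁ d

  Attached Free : Pred Γ.E 0ℓ
  Attached x = ∃[ a ] Γ.s x ≡ φ₀ (G.s a) × (∃[ b ] Encloses a b x) ×
               (∀ {c d} → Encloses c d x → ¬ (φ₁ a ≺ φ₁ c))
  Free x     = Γ.s x ∈ Γ.Source × (∀ {c d} → ¬ Encloses c d x)

  -- tight: x lies immediately before the least edge o leaving v.
  -- attach: x starts at the vertex of the last edge a that opens an
  -- enclosing pair, or at a source of Γ when there is no such pair.
  record WellPlaced : Set where
    field
      tight  : ∀ {v x} → v ∈ G.Source → Γ.t x ≡ φ₀ v →
               ∃[ o ] G.s o ≡ v × x ≺ φ₁ o × (∀ {f} → G.s f ≡ v → ¬ (φ₁ f ≺ φ₁ o)) ×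
                      (∀ {y} → y ≺ φ₁ o → ¬ (x ≺ y))
      attach : ∀ {v x} → v ∈ G.Source → Γ.t x ≡ φ₀ v → Attached x ⊎ Free x

WellPlacedIn WellPlacedOut : ∀ {G} → Skeleton G → Set
WellPlacedIn {G} S = WellPlaced G Γ _≺_ embedding
  where open Skeleton S
WellPlacedOut {G} S = WellPlaced (op G) (op Γ) (flip _≺_) (op-embedding embedding)
  where open Skeleton S

-- Lifting upward planarity from G to Γ

module _ {G : Digraph} (S : Skeleton G) where
  private module G = Graph G
  open Skeleton S
  open StrictOrder sto using (asym; ≺-trans; ≺⇒≢; ⊁⇒≼; _≼_; ≼-≺-trans; ≺-≼-trans; ≼∧≢⇒≺)
  private module Γ = Graph Γ

  source-not-inner : ∀ {z v} → z ∈ Γ.Source → z ≢ φ₀ v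
  source-not-inner {v = v} src refl = let x , tx = inner-in v in src x tx

  -- Sources of Γ and sinks of G each emit a single edge of Γ, which leaves no other place for two
  -- distinct edges to start.
  branching : ∀ {a b} → s a ≡ s b → a ≺ b → ∃[ u ] s a ≡ φ₀ u × ¬ (u ∈ G.Sink)
  branching {a} {b} sab a≺b with vertex (s a)
  ... | inj₁ (u , eq) = u , sym eq , λ snk → ≺⇒≢ a≺b (out-unique snk (sym eq) (trans (sym sab) (sym eq)))
  ... | inj₂ (inj₁ src) = ⊥-elim (≺⇒≢ a≺b (source-unique src refl (sym sab)))
  ... | inj₂ (inj₂ snk) = ⊥-elim (snk a refl)

  module PlacedIn (placed : WellPlacedIn S) where
    open WellPlaced placed

    -- Edges of G that stand in for x, an edge out of u, in arguments about crossings. An old edge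
    -- is its own bound; for an attached stub they are its enclosing pair, and `lo-max` records that
    -- the stub starts innermost.
    record Bounds (u : G.V) (x : Γ.E) : Set where
      field
        lo hi  : G.E
        s-lo   : G.s lo ≡ u
        s-hi   : G.s hi ≡ u
        lo≼    : φ₁ lo ≼ x
        ≼hi    : x ≼ φ₁ hi
        lo-max : ∀ {c d} → Encloses G Γ _≺_ embedding c d x → G.s c ≢ u → φ₁ c ≺ φ₁ lo

    bounds : ∀ {u x} → ¬ (u ∈ G.Sink) → s x ≡ φ₀ u → Bounds u x
    bounds {u} {x} ¬snk sx with edge x
    ... | inj₁ (e , refl) = record
      { lo = e ; hi = e ; s-lo = se ; s-hi = se ; lo≼ = inj₂ refl ; ≼hi = inj₂ refl
      ; lo-max = λ (_ , c≺x , _) _ → c≺x }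
      where
      se : G.s e ≡ u
      se = φ₀-injective (trans (sym (s-φ e)) sx)
    ... | inj₂ (inj₂ (w , snk , sw)) = ⊥-elim (¬snk (subst G.Sink (φ₀-injective (trans (sym sw) sx)) snk))
    ... | inj₂ (inj₁ (v , src , tx)) with attach src tx
    ... | inj₂ (free , _) = ⊥-elim (source-not-inner free sx)
    ... | inj₁ (a , sa , (b , sab , a≺x , x≺b) , max) = record
      { lo = a ; hi = b ; s-lo = sa′ ; s-hi = trans (sym sab) sa′ ; lo≼ = inj₁ a≺x ; ≼hi = inj₁ x≺b
      ; lo-max = λ enc ne → ≼∧≢⇒≺ (⊁⇒≼ (max enc)) (λ eq → ne (trans (cong G.s (φ₁-injective eq)) sa′)) }
      where
      sa′ : G.s a ≡ u
      sa′ = φ₀-injective (trans (sym sa) sx)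

    module _ (up : IsUpward G (_≺_ on φ₁)) where

      -- Replacing a, b, c by their lower bounds and d by its upper bound keeps the order: the
      -- family of a and c encloses b, so by `lo-max` it opens before the bound of b, and likewise
      -- for b, d around c. The result is a crossing in G.
      lift-nc-out : NonCrossing _≺_ s
      lift-nc-out sac sbd a≺b b≺c c≺d with branching sac (≺-trans a≺b b≺c) | branching sbd (≺-trans b≺c c≺d)
      ... | u , sa , ¬snk | u′ , sb , ¬snk′ with u ≟ u′
      ... | yes refl = trans sa (sym sb)
      ... | no ne = ⊥-elim (ne (trans (sym A.s-lo) (trans
          (IsUpward.nc-out up (trans A.s-lo (sym C.s-lo)) (trans B.s-lo (sym D.s-hi)) lo-a≺lo-b lo-b≺lo-c lo-c≺hi-d)
          B.s-lo)))
        where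
        module A = Bounds (bounds ¬snk sa)
        module B = Bounds (bounds ¬snk′ sb)
        module C = Bounds (bounds ¬snk (trans (sym sac) sa))
        module D = Bounds (bounds ¬snk′ (trans (sym sbd) sb))
        lo-a≺lo-b : φ₁ A.lo ≺ φ₁ B.lo
        lo-a≺lo-b = B.lo-max (trans A.s-lo (sym C.s-hi) , ≼-≺-trans A.lo≼ a≺b , ≺-≼-trans b≺c C.≼hi)
                             (λ eq → ne (trans (sym A.s-lo) eq))
        lo-b≺lo-c : φ₁ B.lo ≺ φ₁ C.lo
        lo-b≺lo-c = C.lo-max (trans B.s-lo (sym D.s-hi) , ≼-≺-trans B.lo≼ b≺c , ≺-≼-trans c≺d D.≼hi)
                             (λ eq → ne (trans (sym eq) B.s-lo))
        lo-c≺hi-d : φ₁ C.lo ≺ φ₁ D.hi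
        lo-c≺hi-d = ≼-≺-trans C.lo≼ (≺-≼-trans c≺d D.≼hi)

      -- The stub y sits immediately before m = min O(v), so `gap` for m in G serves for y. Neither
      -- o nor an outgoing witness is m, since their starting vertex has the incoming edge i and v
      -- has none.
      stub-gap : ∀ {y i o} → InStub y → G.t i ≡ G.s o → φ₁ i ≺ y → y ≺ φ₁ o →
                 (∃[ i′ ] G.t i′ ≡ G.t i × ¬ (φ₁ i′ ≺ y)) ⊎ (∃[ o′ ] G.s o′ ≡ G.s o × ¬ (y ≺ φ₁ o′))
      stub-gap {i = i} {o} (v , src , ty) eq i≺y y≺o with tight src ty
      ... | m , refl , y≺m , _ , below with ≼∧≢⇒≺ (⊁⇒≼ λ o≺m → below o≺m y≺o) m≢o
        where
        m≢o : φ₁ m ≢ φ₁ o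
        m≢o e = src i (trans eq (sym (cong G.s (φ₁-injective e))))
      ... | m≺o with IsUpward.gap up eq (≺-trans i≺y y≺m) m≺o
      ... | inj₁ (i′ , ti′ , i′⊀m) = inj₁ (i′ , ti′ , asym (≺-≼-trans y≺m (⊁⇒≼ i′⊀m)))
      ... | inj₂ (o′ , so′ , m⊀o′) = inj₂ (o′ , so′ , below (≼∧≢⇒≺ (⊁⇒≼ m⊀o′)
              λ e → src i (trans eq (trans (sym so′) (cong G.s (φ₁-injective e))))))

    -- Only a free stub could start at a source, and the bounds of a and b form a pair from G around
    -- y, which freeness excludes.
    incoming : ∀ {a y b} → s a ≡ s b → a ≺ y → y ≺ b → ∃[ i ] t i ≡ s y
    incoming {a} {y} {b} sab a≺y y≺b with edge y
    ... | inj₁ (e , refl) = let i , ti = inner-in (G.s e) in i , trans ti (sym (s-φ e))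
    ... | inj₂ (inj₂ (w , _ , sy)) = let i , ti = inner-in w in i , trans ti (sym sy)
    ... | inj₂ (inj₁ (v , src , ty)) with attach src ty
    ... | inj₁ (c , sy , _) = let i , ti = inner-in (G.s c) in i , trans ti (sym sy)
    ... | inj₂ (_ , open-air) with branching sab (≺-trans a≺y y≺b)
    ... | u , sa , ¬snk = ⊥-elim (open-air (trans A.s-lo (sym B.s-hi) , ≼-≺-trans A.lo≼ a≺y , ≺-≼-trans y≺b B.≼hi))
      where
      module A = Bounds (bounds ¬snk sa)
      module B = Bounds (bounds ¬snk (trans (sym sab) sa))

module _ {G : Digraph} (no-isolated : Graph.NoIsolatedVertices G) (S : Skeleton G)
         (placedIn : WellPlacedIn S) (placedOut : WellPlacedOut S)
         (up : IsUpward G (Skeleton._≺_ S on Skeleton.φ₁ S)) where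
  private module G = Graph G
  open Skeleton S
  open StrictOrder sto using (_≼_; ≺-or-≽; ⊁⇒≼; ≼⇒⊁; ≼-trans; ≼-≺-trans; ≺-≼-trans)
  private
    S′ = op-skeleton S
    up′ = op-upward up
    module In = PlacedIn S placedIn
    module Out = PlacedIn S′ placedOut

  private
    inner : ∀ {x y} → t x ≡ s y → ∃[ u ] φ₀ u ≡ t x
    inner {x} {y} eq with vertex (t x)
    ... | inj₁ u          = u
    ... | inj₂ (inj₁ src) = ⊥-elim (src x refl)
    ... | inj₂ (inj₂ snk) = ⊥-elim (snk y (sym eq))

    module InBounds {u x} (¬snk : ¬ (u ∈ G.Sink)) (sx : s x ≡ φ₀ u) = In.Bounds (In.bounds ¬snk sx)

    module OutBounds {u x} (¬src : ¬ (u ∈ G.Source)) (tx : t x ≡ φ₀ u) where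
      -- Lower bounds for the reversed order are upper bounds here.
      open Out.Bounds (Out.bounds ¬src tx) public using () renaming (lo to hi; s-lo to t-hi; lo≼ to ≽hi)
      ≼hi : x ≼ φ₁ hi
      ≼hi = [ inj₁ , inj₂ ∘ sym ]′ ≽hi

    -- At a source of G the edge x is the stub and `tight` puts it before all of O(u), stubs
    -- attached there included, since their lower bounds lie in O(u). Sinks are dual. Elsewhere the
    -- upper bound of x and the lower bound of y are consecutive in G.
    lift-flow : ∀ {x y} → t x ≡ s y → x ≺ y
    lift-flow {x} {y} eq with inner eq
    ... | u , tx with G.source? u | G.sink? u
    ... | yes src | yes snk = ⊥-elim (no-isolated u (src , snk))
    ... | yes src | no ¬snk = let o , so , x≺o , least , _ = WellPlaced.tight placedIn src (sym tx) in
      ≺-≼-trans x≺o (≼-trans (⊁⇒≼ (least Y.s-lo)) Y.lo≼)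
      where module Y = InBounds ¬snk (trans (sym eq) (sym tx))
    ... | no ¬src | yes snk =
      let i , ti , i≺y , greatest , _ = WellPlaced.tight placedOut snk (trans (sym eq) (sym tx)) in
      ≼-≺-trans (≼-trans X.≼hi (⊁⇒≼ (greatest X.t-hi))) i≺y
      where module X = OutBounds ¬src (sym tx)
    ... | no ¬src | no ¬snk =
      ≼-≺-trans X.≼hi (≺-≼-trans (IsUpward.flow up (trans X.t-hi (sym Y.s-lo))) Y.lo≼)
      where
      module X = OutBounds ¬src (sym tx)
      module Y = InBounds ¬snk (trans (sym eq) (sym tx))

    -- At a source of G the edge i is the stub, with nothing between it and min O(u), so this
    -- minimum is the witness; sinks are dual. Elsewhere a bound of i or o is the witness unless y
    -- lies strictly between the two bounds, and then `gap` of G decides.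
    lift-gap : ∀ {i y o} → t i ≡ s o → i ≺ y → y ≺ o →
               (∃[ i′ ] t i′ ≡ t i × ¬ (i′ ≺ y)) ⊎ (∃[ o′ ] s o′ ≡ s o × ¬ (y ≺ o′))
    lift-gap {i} {y} {o} eq i≺y y≺o with inner eq
    ... | u , tu with G.source? u | G.sink? u
    ... | yes src | _ = let m , sm , _ , _ , below = WellPlaced.tight placedIn src (sym tu) in
      inj₂ (φ₁ m , trans (s-φ m) (trans (cong φ₀ sm) (trans tu eq)) , λ y≺m → below y≺m i≺y)
    ... | no _ | yes snk =
      let m , tm , _ , _ , above = WellPlaced.tight placedOut snk (trans (sym eq) (sym tu)) in
      inj₁ (φ₁ m , trans (t-φ m) (trans (cong φ₀ tm) tu) , λ m≺y → above m≺y y≺o)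
    ... | no ¬src | no ¬snk with ≺-or-≽ (φ₁ X.hi) y | ≺-or-≽ y (φ₁ Y.lo)
      where
      module X = OutBounds ¬src (sym tu)
      module Y = InBounds ¬snk (trans (sym eq) (sym tu))
    ... | inj₂ y≼hi | _ = inj₁ (_ , trans (t-φ _) (trans (cong φ₀ X.t-hi) tu) , ≼⇒⊁ y≼hi)
      where module X = OutBounds ¬src (sym tu)
    ... | inj₁ _ | inj₂ lo≼y = inj₂ (_ , trans (s-φ _) (trans (cong φ₀ Y.s-lo) (trans tu eq)) , ≼⇒⊁ lo≼y)
      where module Y = InBounds ¬snk (trans (sym eq) (sym tu))
    ... | inj₁ hi≺y | inj₁ y≺lo = lift (old-gap (edge y))
      where
      module X = OutBounds ¬src (sym tu)
      module Y = InBounds ¬snk (trans (sym eq) (sym tu))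
      through-u : G.t X.hi ≡ G.s Y.lo
      through-u = trans X.t-hi (sym Y.s-lo)

      OldGap : Set
      OldGap = (∃[ i′ ] G.t i′ ≡ G.t X.hi × ¬ (φ₁ i′ ≺ y)) ⊎ (∃[ o′ ] G.s o′ ≡ G.s Y.lo × ¬ (y ≺ φ₁ o′))

      old-gap : Image φ₁ y ⊎ InStub y ⊎ OutStub y → OldGap
      old-gap (inj₁ (e , refl))   = IsUpward.gap up through-u hi≺y y≺lo
      old-gap (inj₂ (inj₁ stub)) = In.stub-gap up stub through-u hi≺y y≺lo
      old-gap (inj₂ (inj₂ stub)) = swap (Out.stub-gap up′ stub (sym through-u) y≺lo hi≺y)

      lift : OldGap → _
      lift (inj₁ (i′ , ti′ , i′⊀y)) =
        inj₁ (φ₁ i′ , trans (t-φ i′) (trans (cong φ₀ (trans ti′ X.t-hi)) tu) , i′⊀y)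
      lift (inj₂ (o′ , so′ , y⊀o′)) =
        inj₂ (φ₁ o′ , trans (s-φ o′) (trans (cong φ₀ (trans so′ Y.s-lo)) (trans tu eq)) , y⊀o′)

  lift-upward : IsUpward Γ _≺_
  lift-upward = record
    { flow   = lift-flow
    ; gap    = lift-gap
    ; nc-in  = flip-noncrossing {f = t} (Out.lift-nc-out up′)
    ; nc-out = In.lift-nc-out up
    }

  lift-planar : Planar Γ _≺_
  lift-planar = upward⇒planar sto lift-upward In.incoming Out.incoming

-- Stubs of CPP-extensions

-- P₁, P₂ and E₄ as they apply to a skeleton. A stub into v is the only edge ending there, so of the
-- two alternatives in E₄ only the one at its start remains; dually for stubs out.
record Interlocked {G} (S : Skeleton G) : Set where
  open Skeleton S
  private module Γ = Graph Γ
  field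
    flow   : ∀ {x y} → t x ≡ s y → x ≺ y
    planar : Planar Γ _≺_
    inside-in  : ∀ {x} → InStub x → s x ∈ Γ.Source ⊎ ∃[ a ] ∃[ b ] s a ≡ s x × s b ≡ s x × a ≺ x × x ≺ b
    inside-out : ∀ {x} → OutStub x → t x ∈ Γ.Sink ⊎ ∃[ a ] ∃[ b ] t a ≡ t x × t b ≡ t x × x ≺ a × b ≺ x

op-interlocked : ∀ {G} {S : Skeleton G} → Interlocked S → Interlocked (op-skeleton S)
op-interlocked {S = S} I = record
  { flow       = λ eq → flow (sym eq)
  ; planar     = op-planar {Skeleton.Γ S} planar
  ; inside-in  = inside-out
  ; inside-out = inside-in
  }
  where open Interlocked I

module _ {G : Digraph} {S : Skeleton G} (I : Interlocked S) where
  open Skeleton S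
  open Interlocked I
  private module Γ = Graph Γ

  interlocked⇒upward : IsUpward Γ _≺_
  interlocked⇒upward = planar⇒upward sto flow planar
    (λ sab a≺b → let u , sa , _ = branching S sab a≺b ; i , ti = inner-in u in i , trans ti (sym sa))
    (λ tab b≺a → let u , ta , _ = branching (op-skeleton S) tab b≺a ; o , so = inner-out u in o , trans so (sym ta))

module _ {G : Digraph} (no-isolated : Graph.NoIsolatedVertices G) {S : Skeleton G} (I : Interlocked S) where
  private module G = Graph G
  open Skeleton S
  open Interlocked I
  private module Γ = Graph Γ
  open StrictOrder sto
  open Walks {Γ} flow ≺-trans

  private
    Inside : Γ.E → Set
    Inside x = ∃[ a ] ∃[ b ] s a ≡ s x × s b ≡ s x × a ≺ x × x ≺ b

    -- An edge strictly inside its family is neither its minimum nor its maximum; hence the extremes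
    -- of O(z) come from G.
    OldExtremes : Γ.V → Set
    OldExtremes z = ∀ x → s x ≡ z → Image φ₁ x ⊎ Inside x

    old-below : ∀ {z} → OldExtremes z → ∀ {x} → s x ≡ z → ∃[ e ] s (φ₁ e) ≡ z × φ₁ e ≼ x
    old-below {z} ext {x} sx with ≺-min sto (λ y → s y ≟ z) (x , sx)
    ... | m , sm , least with ext m sm
    ... | inj₁ (e , refl) = e , sm , least sx
    ... | inj₂ (a , _ , sa , _ , a≺m , _) = ⊥-elim (≼⇒⊁ (least (trans sa sm)) a≺m)

    old-above : ∀ {z} → OldExtremes z → ∀ {x} → s x ≡ z → ∃[ e ] s (φ₁ e) ≡ z × x ≼ φ₁ e
    old-above {z} ext {x} sx with ≺-max sto (λ y → s y ≟ z) (x , sx)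
    ... | m , sm , greatest with ext m sm
    ... | inj₁ (e , refl) = e , sm , greatest sx
    ... | inj₂ (_ , b , _ , sb , _ , m≺b) = ⊥-elim (≼⇒⊁ (greatest (trans sb sm)) m≺b)

    inner-extremes : ∀ {v} → v ∈ G.Source → OldExtremes (φ₀ v)
    inner-extremes {v} src x sx with edge x
    ... | inj₁ old = inj₁ old
    ... | inj₂ (inj₂ (w , snk , sw)) =
      ⊥-elim (no-isolated v (src , subst G.Sink (φ₀-injective (trans (sym sw) sx)) snk))
    ... | inj₂ (inj₁ stub) with inside-in stub
    ... | inj₁ src′   = ⊥-elim (source-not-inner S src′ sx)
    ... | inj₂ inside = inj₂ inside

    stub-extremes : ∀ {x} → InStub x → Inside x → OldExtremes (s x)
    stub-extremes {x} stub (a , _ , sa , _ , a≺x , _) y sy with edge y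
    ... | inj₁ old = inj₁ old
    ... | inj₂ (inj₂ (w , snk , sw)) = ⊥-elim (disjoint stub (w , snk , trans (sym sy) sw))
    ... | inj₂ (inj₁ stub′) with inside-in stub′
    ... | inj₁ src    = ⊥-elim (≺⇒≢ a≺x (source-unique src (trans sa (sym sy)) (sym sy)))
    ... | inj₂ inside = inj₂ inside

    -- The extremes of the family at `s x` are old, so a pair from G encloses x. Take m to be the
    -- last old edge of this family before x: a pair c, d around x with m ≺ c must belong to the
    -- same family by noncrossing, against the choice of m.
    attached : ∀ {x} → InStub x → Inside x → Attached G Γ _≺_ embedding x
    attached {x} stub inside@(a , b , sa , sb , a≺x , x≺b)
      with old-below (stub-extremes stub inside) sa | old-above (stub-extremes stub inside) sb
    ... | a′ , sa′ , a′≼a | b′ , sb′ , b≼b′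
      with ≺-max (on-sto φ₁-injective sto) (λ e → (s (φ₁ e) ≟ s x) ×-dec (φ₁ e <? x))
                 (a′ , sa′ , ≼-≺-trans a′≼a a≺x)
    ... | m , (sm , m≺x) , greatest =
      m , trans (sym sm) (s-φ m) ,
      (b′ , φ₀-injective (trans (sym (s-φ m)) (trans sm (trans (sym sb′) (s-φ b′)))) , m≺x , x≺b′) ,
      maximal
      where
      x≺b′ : x ≺ φ₁ b′
      x≺b′ = ≺-≼-trans x≺b b≼b′
      maximal : ∀ {c d} → Encloses G Γ _≺_ embedding c d x → ¬ (φ₁ m ≺ φ₁ c)
      maximal {c} {d} (scd , c≺x , x≺d) m≺c = StrictOrder.≼⇒⊁ (on-sto φ₁-injective sto) (greatest (sc , c≺x)) m≺c
        where
        sc : s (φ₁ c) ≡ s x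
        sc = trans (sym (IsUpward.nc-out (interlocked⇒upward I) sm
               (trans (s-φ c) (trans (cong φ₀ scd) (sym (s-φ d)))) m≺c c≺x x≺d)) sm

    -- The vertex of an enclosing pair has an incoming edge, from which x would be reachable; so
    -- some edge would end at `s x`.
    free : ∀ {x} → s x ∈ Γ.Source → Free G Γ _≺_ embedding x
    free {x} src = src , λ {c} {d} (scd , c≺x , x≺d) →
      let i , ti = inner-in (G.s c)
          k , tk , _ = last-step (planar⇒reachable sto flow planar (trans ti (sym (s-φ c)))
                                   (trans (s-φ c) (trans (cong φ₀ scd) (sym (s-φ d)))) c≺x x≺d)
      in src k tk

    first-out : ∀ {v} → v ∈ G.Source → ∃[ e ] G.s e ≡ v
    first-out {v} src with any? (G.out? v)
    ... | yes e  = e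
    ... | no ¬e  = ⊥-elim (no-isolated v (src , λ e se → ¬e (e , se)))

    -- For x ≺ y ≺ o apply P₂ to the step from x to o. A walk to y starts with an edge of O(v),
    -- which has an old edge of O(v) at or below it, against the minimality of o; a walk from y to o
    -- enters v, and only x does.
    tight : ∀ {v x} → v ∈ G.Source → t x ≡ φ₀ v →
            ∃[ o ] G.s o ≡ v × x ≺ φ₁ o × (∀ {f} → G.s f ≡ v → ¬ (φ₁ f ≺ φ₁ o)) ×
                   (∀ {y} → y ≺ φ₁ o → ¬ (x ≺ y))
    tight {v} {x} src tx with ≺-min (on-sto φ₁-injective sto) (G.out? v) (first-out src)
    ... | o , so , least = o , so , flow x→o , StrictOrder.≼⇒⊁ (on-sto φ₁-injective sto) ∘ least , tight′
      where
      s-φo : s (φ₁ o) ≡ φ₀ v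
      s-φo = trans (s-φ o) (cong φ₀ so)
      x→o : t x ≡ s (φ₁ o)
      x→o = trans tx (sym s-φo)
      tight′ : ∀ {y} → y ≺ φ₁ o → ¬ (x ≺ y)
      tight′ y≺o x≺y with planar [ x→o ] x≺y y≺o
      ... | inj₁ walk = let g , sg , g≼y = first-step walk
                            f , sf , f≼g = old-below (inner-extremes src) (trans sg tx) in
        StrictOrder.≼⇒⊁ (on-sto φ₁-injective sto) (least (φ₀-injective (trans (sym (s-φ f)) sf)))
          (≼-≺-trans (≼-trans f≼g g≼y) y≺o)
      ... | inj₂ walk with last-step walk
      ... | k , tk , y→k with in-unique src (trans tk s-φo) tx
      ... | refl = [ (λ eq → ≺⇒≢ x≺y (sym eq)) , (λ w → asym x≺y (walk⇒≺ w)) ]′ y→k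

  interlocked⇒wellPlacedIn : WellPlacedIn S
  interlocked⇒wellPlacedIn = record
    { tight  = tight
    ; attach = λ {v} src tx → [ inj₂ ∘ free , inj₁ ∘ attached (v , src , tx) ]′ (inside-in (v , src , tx))
    }

-- Restricting upward planarity from Γ to G

module _ {G : Digraph} {S : Skeleton G} (placedIn : WellPlacedIn S) (placedOut : WellPlacedOut S)
         (up : IsUpward (Skeleton.Γ S) (Skeleton._≺_ S)) where
  private module G = Graph G
  open Skeleton S
  open StrictOrder sto

  -- Only `gap` can leave G, its witness in Γ being possibly a stub. The old bound of the witness on
  -- the far side from y is again a witness.
  restrict-upward : IsUpward G (_≺_ on φ₁)
  restrict-upward = record
    { flow   = λ eq → flow (trans (t-φ _) (trans (cong φ₀ eq) (sym (s-φ _))))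
    ; gap    = restrict-gap
    ; nc-in  = λ p q ab bc cd → φ₀-injective (trans (sym (t-φ _)) (trans (nc-in (lift-t p) (lift-t q) ab bc cd) (t-φ _)))
    ; nc-out = λ p q ab bc cd → φ₀-injective (trans (sym (s-φ _)) (trans (nc-out (lift-s p) (lift-s q) ab bc cd) (s-φ _)))
    }
    where
    open IsUpward up
    lift-t : ∀ {a b} → G.t a ≡ G.t b → t (φ₁ a) ≡ t (φ₁ b)
    lift-t eq = trans (t-φ _) (trans (cong φ₀ eq) (sym (t-φ _)))
    lift-s : ∀ {a b} → G.s a ≡ G.s b → s (φ₁ a) ≡ s (φ₁ b)
    lift-s eq = trans (s-φ _) (trans (cong φ₀ eq) (sym (s-φ _)))

    restrict-gap : ∀ {i y o} → G.t i ≡ G.s o → φ₁ i ≺ φ₁ y → φ₁ y ≺ φ₁ o →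
                   (∃[ i′ ] G.t i′ ≡ G.t i × ¬ (φ₁ i′ ≺ φ₁ y)) ⊎ (∃[ o′ ] G.s o′ ≡ G.s o × ¬ (φ₁ y ≺ φ₁ o′))
    restrict-gap {i} {y} {o} eq i≺y y≺o
      with gap (trans (t-φ i) (trans (cong φ₀ eq) (sym (s-φ o)))) i≺y y≺o
    ... | inj₁ (i′ , ti′ , i′⊀y) =
      inj₁ (O.lo , O.s-lo , λ e≺y → i′⊀y (≼-≺-trans ([ inj₁ , inj₂ ∘ sym ]′ O.lo≼) e≺y))
      where module O = PlacedIn.Bounds (PlacedIn.bounds (op-skeleton S) placedOut
                         (λ src → src i refl) (trans ti′ (t-φ i)))
    ... | inj₂ (o′ , so′ , y⊀o′) =
      inj₂ (O.lo , O.s-lo , λ y≺e → y⊀o′ (≺-≼-trans y≺e O.lo≼))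
      where module O = PlacedIn.Bounds (PlacedIn.bounds S placedIn
                         (λ snk → snk o refl) (trans so′ (s-φ o)))

-- Uniqueness of the extension

module _ {A : Set} where

  -- A stub before e has key (e , 0), the edge e itself (e , 1), and a stub
  -- after e has key (e , 2).
  Key< : Rel A 0ℓ → Rel (A × Fin 3) 0ℓ
  Key< _≺_ = ×-Lex _≡_ _≺_ Fin._<_

  key-sto : {_≺_ : Rel A 0ℓ} → IsStrictTotalOrder _≡_ _≺_ → IsStrictTotalOrder _≡_ (Key< _≺_)
  key-sto {_≺_} sto = isStrictTotalOrderᶜ record
    { isEquivalence = isEquivalence
    ; trans         = IsStrictTotalOrder.trans lex
    ; compare       = compare
    }
    where
    lex : IsStrictTotalOrder _ (Key< _≺_)
    lex = ×-isStrictTotalOrder sto Fin.<-isStrictTotalOrder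
    compare : Trichotomous _≡_ (Key< _≺_)
    compare k l with IsStrictTotalOrder.compare lex k l
    ... | tri< a b c = tri< a (b ∘ ≡⇒≡×≡) c
    ... | tri≈ a b c = tri≈ a (≡×≡⇒≡ b) c
    ... | tri> a b c = tri> a (b ∘ ≡⇒≡×≡) c

module _ {G : Digraph} (S : Skeleton G) where
  private module G = Graph G
  open Skeleton S
  open StrictOrder sto

  -- The content of `tight` indexed by the anchor e, which becomes the first component of the key of
  -- x.
  record Before (x : Digraph.E Γ) (e : G.E) : Set where
    constructor before
    field
      source    : G.s e ∈ G.Source
      t-stub    : t x ≡ φ₀ (G.s e)
      x≺e       : x ≺ φ₁ e
      least     : ∀ {f} → G.s f ≡ G.s e → ¬ (φ₁ f ≺ φ₁ e)
      immediate : ∀ {y} → y ≺ φ₁ e → ¬ (x ≺ y)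

  tight⇒before : WellPlacedIn S → ∀ {x} → InStub x → ∃ (Before x)
  tight⇒before placed (v , src , tx) with WellPlaced.tight placed src tx
  ... | o , refl , x≺o , least , immediate = o , before src tx x≺o least immediate

  old-not-in : ∀ {x} → Image φ₁ x → InStub x → ⊥
  old-not-in (e , refl) (v , src , tx) = src e (φ₀-injective (trans (sym (t-φ e)) tx))

  before⇒InStub : ∀ {x e} → Before x e → InStub x
  before⇒InStub {e = e} (before src tx _ _ _) = G.s e , src , tx

  before-≺ : ∀ {x e f} → Before x e → φ₁ f ≺ φ₁ e → φ₁ f ≺ x
  before-≺ {x} {e} {f} B f≺e =
    ≼∧≢⇒≺ (⊁⇒≼ (Before.immediate B f≺e)) (λ { refl → old-not-in (f , refl) (before⇒InStub B) })

  before-unique : ∀ {x y e} → Before x e → Before y e → x ≡ y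
  before-unique B C = in-unique (Before.source B) (Before.t-stub B) (Before.t-stub C)

  before-least-unique : ∀ {x e f} → Before x e → Before x f → ¬ (φ₁ e ≺ φ₁ f)
  before-least-unique B C = Before.least C (φ₀-injective (trans (sym (Before.t-stub B)) (Before.t-stub C)))

module _ {G : Digraph} (S : Skeleton G) where
  private module G = Graph G
  open Skeleton S
  open StrictOrder sto
  private
    S′ = op-skeleton S
    module Γ = Graph Γ

  HasKey : Γ.E → G.E × Fin 3 → Set
  HasKey x (e , zero)          = Before S x e
  HasKey x (e , suc zero)      = φ₁ e ≡ x
  HasKey x (e , suc (suc _))   = Before S′ x e

  key : WellPlacedIn S → WellPlacedOut S → ∀ x → ∃ (HasKey x)
  key placedIn placedOut x with edge x
  ... | inj₁ (e , eq)    = (e , suc zero) , eq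
  ... | inj₂ (inj₁ stub) = let e , B = tight⇒before S placedIn stub in (e , zero) , B
  ... | inj₂ (inj₂ stub) = let e , B = tight⇒before S′ placedOut stub in (e , suc (suc zero)) , B

  same-key : ∀ {x y} k → HasKey x k → HasKey y k → x ≡ y
  same-key (_ , zero)        B C = before-unique S B C
  same-key (_ , suc zero)    p q = trans (sym p) q
  same-key (_ , suc (suc _)) B C = before-unique S′ B C

  -- For anchors e ≺ f every edge with anchor e precedes f, since nothing separates e from the stub
  -- after it. It then precedes the stub before f as well, as nothing separates that stub from f
  -- either.
  key-mono : ∀ {x y} k l → HasKey x k → HasKey y l → Key< (_≺_ on φ₁) k l → x ≺ y
  key-mono {x} {y} (e , p) (f , q) X Y (inj₁ e≺f) = go p q X Y
    where
    below : ∀ p → HasKey x (e , p) → x ≺ φ₁ f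
    below zero          B    = ≺-trans (Before.x≺e B) e≺f
    below (suc zero)    refl = e≺f
    below (suc (suc _)) B    = before-≺ S′ B e≺f

    distinct : ∀ p → HasKey x (e , p) → ¬ Before S x f
    distinct zero          B    C = before-least-unique S B C e≺f
    distinct (suc zero)    eq   C = old-not-in S (e , eq) (before⇒InStub S C)
    distinct (suc (suc _)) B    C = disjoint (before⇒InStub S C) (before⇒InStub S′ B)

    go : ∀ p q → HasKey x (e , p) → HasKey y (f , q) → x ≺ y
    go p zero          X C    = ≼∧≢⇒≺ (⊁⇒≼ (Before.immediate C (below p X))) (λ { refl → distinct p X C })
    go p (suc zero)    X refl = below p X
    go p (suc (suc _)) X C    = ≺-trans (below p X) (Before.x≺e C)
  key-mono (e , p) (_ , q) X Y (inj₂ (refl , p<q)) = go p q X Y p<q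
    where
    go : ∀ p q → HasKey _ (e , p) → HasKey _ (e , q) → p Fin.< q → _ ≺ _
    go zero zero _ _ ()
    go zero (suc zero)       B refl _ = Before.x≺e B
    go zero (suc (suc zero)) B C    _ = ≺-trans (Before.x≺e B) (Before.x≺e C)
    go (suc zero) zero _ _ ()
    go (suc zero) (suc zero) _ _ (s≤s ())
    go (suc zero) (suc (suc zero)) refl C _ = Before.x≺e C
    go (suc (suc zero)) zero _ _ ()
    go (suc (suc zero)) (suc zero) _ _ (s≤s ())
    go (suc (suc zero)) (suc (suc zero)) _ _ (s≤s (s≤s ()))

  key-reflect : ∀ {x y} k l → HasKey x k → HasKey y l → x ≺ y → Key< (_≺_ on φ₁) k l
  key-reflect k l X Y x≺y with IsStrictTotalOrder.compare (key-sto (on-sto φ₁-injective sto)) k l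
  ... | tri< k<l _ _  = k<l
  ... | tri≈ _ refl _ = ⊥-elim (≺⇒≢ x≺y (same-key k X Y))
  ... | tri> _ _ l<k  = ⊥-elim (asym x≺y (key-mono l k Y X l<k))

module _ {G : Digraph} (X Y : Skeleton G) where
  private
    module G = Graph G
    module X = Skeleton X
    module Y = Skeleton Y
    module XΓ = Graph X.Γ
    module YΓ = Graph Y.Γ

  SameOrder : Set
  SameOrder = ∀ e f → X.φ₁ e X.≺ X.φ₁ f ⇔ Y.φ₁ e Y.≺ Y.φ₁ f

  -- A relation in place of a map: it is symmetric in X and Y, so totality and functionality proved
  -- once give a map together with its inverse.
  CorrE : XΓ.E → YΓ.E → Set
  CorrE x y = (∃[ e ] X.φ₁ e ≡ x × Y.φ₁ e ≡ y)
            ⊎ (∃[ v ] v ∈ G.Source × X.t x ≡ X.φ₀ v × Y.t y ≡ Y.φ₀ v)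
            ⊎ (∃[ v ] v ∈ G.Sink × X.s x ≡ X.φ₀ v × Y.s y ≡ Y.φ₀ v)

  -- Sources and sinks have no counterpart in G and are matched through the one edge that each of
  -- them carries.
  CorrV : XΓ.V → YΓ.V → Set
  CorrV z z′ = (∃[ v ] X.φ₀ v ≡ z × Y.φ₀ v ≡ z′)
             ⊎ (∃[ x ] ∃[ y ] CorrE x y × X.s x ≡ z × Y.s y ≡ z′ × z ∈ XΓ.Source × z′ ∈ YΓ.Source)
             ⊎ (∃[ x ] ∃[ y ] CorrE x y × X.t x ≡ z × Y.t y ≡ z′ × z ∈ XΓ.Sink × z′ ∈ YΓ.Sink)

  corrE-total : ∀ x → ∃ (CorrE x)
  corrE-total x with X.edge x
  ... | inj₁ (e , eq) = Y.φ₁ e , inj₁ (e , eq , refl)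
  ... | inj₂ (inj₁ (v , src , tx)) = let y , ty = Y.inner-in v in y , inj₂ (inj₁ (v , src , tx , ty))
  ... | inj₂ (inj₂ (v , snk , sx)) = let y , sy = Y.inner-out v in y , inj₂ (inj₂ (v , snk , sx , sy))

  corrE-functional : ∀ {x y y′} → CorrE x y → CorrE x y′ → y ≡ y′
  corrE-functional (inj₁ (e , ex , ey)) (inj₁ (f , fx , fy)) with X.φ₁-injective (trans ex (sym fx))
  ... | refl = trans (sym ey) fy
  corrE-functional (inj₂ (inj₁ (v , src , tx , ty))) (inj₂ (inj₁ (w , _ , tx′ , ty′)))
    with X.φ₀-injective (trans (sym tx) tx′)
  ... | refl = Y.in-unique src ty ty′
  corrE-functional (inj₂ (inj₂ (v , snk , sx , sy))) (inj₂ (inj₂ (w , _ , sx′ , sy′)))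
    with X.φ₀-injective (trans (sym sx) sx′)
  ... | refl = Y.out-unique snk sy sy′
  corrE-functional (inj₁ (e , ex , _)) (inj₂ (inj₁ (v , src , tx , _))) =
    ⊥-elim (old-not-in X (e , ex) (v , src , tx))
  corrE-functional (inj₁ (e , ex , _)) (inj₂ (inj₂ (v , snk , sx , _))) =
    ⊥-elim (old-not-in (op-skeleton X) (e , ex) (v , snk , sx))
  corrE-functional (inj₂ (inj₁ (v , src , tx , _))) (inj₁ (e , ex , _)) =
    ⊥-elim (old-not-in X (e , ex) (v , src , tx))
  corrE-functional (inj₂ (inj₂ (v , snk , sx , _))) (inj₁ (e , ex , _)) =
    ⊥-elim (old-not-in (op-skeleton X) (e , ex) (v , snk , sx))
  corrE-functional (inj₂ (inj₁ (v , src , tx , _))) (inj₂ (inj₂ (w , snk , sx , _))) =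
    ⊥-elim (X.disjoint (v , src , tx) (w , snk , sx))
  corrE-functional (inj₂ (inj₂ (w , snk , sx , _))) (inj₂ (inj₁ (v , src , tx , _))) =
    ⊥-elim (X.disjoint (v , src , tx) (w , snk , sx))

  corrV-functional : ∀ {z y y′} → CorrV z y → CorrV z y′ → y ≡ y′
  corrV-functional (inj₁ (v , vz , vy)) (inj₁ (w , wz , wy)) with X.φ₀-injective (trans vz (sym wz))
  ... | refl = trans (sym vy) wy
  corrV-functional (inj₂ (inj₁ (x , y , c , sx , sy , src , _))) (inj₂ (inj₁ (x′ , y′ , c′ , sx′ , sy′ , _)))
    with X.source-unique src sx sx′
  ... | refl = trans (sym sy) (trans (cong Y.s (corrE-functional c c′)) sy′)
  corrV-functional (inj₂ (inj₂ (x , y , c , tx , ty , snk , _))) (inj₂ (inj₂ (x′ , y′ , c′ , tx′ , ty′ , _)))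
    with X.sink-unique snk tx tx′
  ... | refl = trans (sym ty) (trans (cong Y.t (corrE-functional c c′)) ty′)
  corrV-functional (inj₁ (v , vz , _)) (inj₂ (inj₁ (_ , _ , _ , _ , _ , src , _))) =
    ⊥-elim (source-not-inner X src (sym vz))
  corrV-functional (inj₁ (v , vz , _)) (inj₂ (inj₂ (_ , _ , _ , _ , _ , snk , _))) =
    ⊥-elim (source-not-inner (op-skeleton X) snk (sym vz))
  corrV-functional (inj₂ (inj₁ (_ , _ , _ , _ , _ , src , _))) (inj₁ (v , vz , _)) =
    ⊥-elim (source-not-inner X src (sym vz))
  corrV-functional (inj₂ (inj₂ (_ , _ , _ , _ , _ , snk , _))) (inj₁ (v , vz , _)) =
    ⊥-elim (source-not-inner (op-skeleton X) snk (sym vz))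
  corrV-functional (inj₂ (inj₁ (x , _ , _ , sx , _))) (inj₂ (inj₂ (_ , _ , _ , _ , _ , snk , _))) = ⊥-elim (snk x sx)
  corrV-functional (inj₂ (inj₂ (_ , _ , _ , _ , _ , snk , _))) (inj₂ (inj₁ (x , _ , _ , sx , _))) = ⊥-elim (snk x sx)

module _ {G : Digraph} {X Y : Skeleton G} where

  corrE-sym : ∀ {x y} → CorrE X Y x y → CorrE Y X y x
  corrE-sym (inj₁ (e , p , q))             = inj₁ (e , q , p)
  corrE-sym (inj₂ (inj₁ (v , src , p , q))) = inj₂ (inj₁ (v , src , q , p))
  corrE-sym (inj₂ (inj₂ (v , snk , p , q))) = inj₂ (inj₂ (v , snk , q , p))

  corrV-sym : ∀ {z z′} → CorrV X Y z z′ → CorrV Y X z′ z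
  corrV-sym (inj₁ (v , p , q)) = inj₁ (v , q , p)
  corrV-sym (inj₂ (inj₁ (x , y , c , p , q , a , b))) = inj₂ (inj₁ (y , x , corrE-sym c , q , p , b , a))
  corrV-sym (inj₂ (inj₂ (x , y , c , p , q , a , b))) = inj₂ (inj₂ (y , x , corrE-sym c , q , p , b , a))

  corrE-op : ∀ {x y} → CorrE X Y x y → CorrE (op-skeleton X) (op-skeleton Y) x y
  corrE-op = [ inj₁ , inj₂ ∘ swap ]′

  corrV-unop : ∀ {z z′} → CorrV (op-skeleton X) (op-skeleton Y) z z′ → CorrV X Y z z′
  corrV-unop (inj₁ c) = inj₁ c
  corrV-unop (inj₂ (inj₁ (x , y , c , rest))) = inj₂ (inj₂ (x , y , [ inj₁ , inj₂ ∘ swap ]′ c , rest))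
  corrV-unop (inj₂ (inj₂ (x , y , c , rest))) = inj₂ (inj₁ (x , y , [ inj₁ , inj₂ ∘ swap ]′ c , rest))

  sameOrder-op : SameOrder X Y → SameOrder (op-skeleton X) (op-skeleton Y)
  sameOrder-op same e f = same f e

module _ {G : Digraph} {X Y : Skeleton G} (same : SameOrder X Y) where
  private
    module X = Skeleton X
    module Y = Skeleton Y

  -- Both anchors are the minimum of O(v) for the common order on E(G).
  corr-before : WellPlacedIn Y → ∀ {x y e} → CorrE X Y x y → Before X x e → Before Y y e
  corr-before placed (inj₁ (f , fx , _)) B = ⊥-elim (old-not-in X (f , fx) (before⇒InStub X B))
  corr-before placed (inj₂ (inj₂ (w , snk , sx , _))) B = ⊥-elim (X.disjoint (before⇒InStub X B) (w , snk , sx))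
  corr-before placed {e = e} (inj₂ (inj₁ (v , src , tx , ty))) B
    with X.φ₀-injective (trans (sym tx) (Before.t-stub B))
  ... | refl with WellPlaced.tight placed src ty
  ... | o , so , y≺o , least , immediate with Y.φ₁-injective (StrictOrder.≼-antisym Y.sto
          (StrictOrder.⊁⇒≼ Y.sto (λ o≺e → Before.least B so (Equivalence.from (same o e) o≺e)))
          (StrictOrder.⊁⇒≼ Y.sto (least refl)))
  ... | refl = before src ty y≺o least immediate

WellPlacedBoth : ∀ {G} → Skeleton G → Set
WellPlacedBoth S = WellPlacedIn S × WellPlacedOut S

op-placed : ∀ {G} {S : Skeleton G} → WellPlacedBoth S → WellPlacedBoth (op-skeleton S)
op-placed (placedIn , placedOut) = placedOut , placedIn

module _ {G : Digraph} (X Y : Skeleton G) (placedX : WellPlacedBoth X) (placedY : WellPlacedBoth Y)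
         (same : SameOrder X Y) where
  private
    module X = Skeleton X
    module Y = Skeleton Y

  corrE-key : ∀ {x y} k → CorrE X Y x y → HasKey X x k → HasKey Y y k
  corrE-key (_ , zero)        c B  = corr-before {X = X} {Y} same (proj₁ placedY) c B
  corrE-key (e , suc zero)    c eq = corrE-functional X Y (inj₁ (e , eq , refl)) c
  corrE-key (_ , suc (suc _)) c B  =
    corr-before {X = op-skeleton X} {op-skeleton Y} (sameOrder-op {X = X} {Y} same) (proj₂ placedY) (corrE-op {X = X} {Y} c) B

  -- Corresponding edges have the same key, and keys are compared by the order on E(G) alone.
  corrE-mono : ∀ {x x′ y y′} → CorrE X Y x y → CorrE X Y x′ y′ → x X.≺ x′ → y Y.≺ y′
  corrE-mono {x} {x′} c c′ x≺x′ with key X (proj₁ placedX) (proj₂ placedX) x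
                                   | key X (proj₁ placedX) (proj₂ placedX) x′
  ... | k , hk | l , hl = key-mono Y k l (corrE-key k c hk) (corrE-key l c′ hl)
      ([ inj₁ ∘ Equivalence.to (same _ _) , inj₂ ]′ (key-reflect X k l hk hl x≺x′))

module _ {G : Digraph} (X Y : Skeleton G) (placedX : WellPlacedBoth X) (placedY : WellPlacedBoth Y)
         (same : SameOrder X Y) where
  private
    module X = Skeleton X
    module Y = Skeleton Y

    encloses : ∀ {a b x y} → CorrE X Y x y → Encloses G X.Γ X._≺_ X.embedding a b x →
               Encloses G Y.Γ Y._≺_ Y.embedding a b y
    encloses {a} {b} c (sab , a≺x , x≺b) =
      sab , corrE-mono X Y placedX placedY same (inj₁ (a , refl , refl)) c a≺x
          , corrE-mono X Y placedX placedY same c (inj₁ (b , refl , refl)) x≺b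

  module _ {x y} (c : CorrE X Y x y) where
    private
      unencloses : ∀ {a b} → Encloses G Y.Γ Y._≺_ Y.embedding a b y → Encloses G X.Γ X._≺_ X.embedding a b x
      unencloses {a} {b} (sab , a≺y , y≺b) =
        sab , corrE-mono Y X placedY placedX same′ (inj₁ (a , refl , refl)) c′ a≺y
            , corrE-mono Y X placedY placedX same′ c′ (inj₁ (b , refl , refl)) y≺b
        where
        same′ : SameOrder Y X
        same′ e f = mk⇔ (Equivalence.from (same e f)) (Equivalence.to (same e f))
        c′ : CorrE Y X y x
        c′ = corrE-sym {X = X} {Y} c

    -- Corresponding stubs are enclosed by the same pairs, so both are free or both are attached; in
    -- the latter case neither opening edge can come after the other.
    corrV-s : CorrV X Y (X.s x) (Y.s y)
    corrV-s = go c
      where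
      go : CorrE X Y x y → CorrV X Y (X.s x) (Y.s y)
      go (inj₁ (e , refl , refl)) = inj₁ (_ , sym (X.s-φ e) , sym (Y.s-φ e))
      go (inj₂ (inj₂ (v , _ , sx , sy))) = inj₁ (v , sym sx , sym sy)
      go (inj₂ (inj₁ (v , src , tx , ty)))
        with WellPlaced.attach (proj₁ placedX) src tx | WellPlaced.attach (proj₁ placedY) src ty
      ... | inj₂ (srcX , _) | inj₂ (srcY , _) = inj₂ (inj₁ (x , y , c , refl , refl , srcX , srcY))
      ... | inj₁ (a , _ , (b , enc) , _) | inj₂ (_ , free) = ⊥-elim (free (encloses c enc))
      ... | inj₂ (_ , free) | inj₁ (a , _ , (b , enc) , _) = ⊥-elim (free (unencloses enc))
      ... | inj₁ (a , sx , (b , enc) , max) | inj₁ (a′ , sy , (b′ , enc′) , max′)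
        with X.φ₁-injective (StrictOrder.≼-antisym X.sto
               (StrictOrder.⊁⇒≼ X.sto (λ a′≺a → max′ (encloses c enc) (Equivalence.to (same _ _) a′≺a)))
               (StrictOrder.⊁⇒≼ X.sto (max (unencloses enc′))))
      ... | refl = inj₁ (G.s a , sym sx , sym sy)
        where module G = Digraph G

module _ {G : Digraph} (X Y : Skeleton G) (placedX : WellPlacedBoth X) (placedY : WellPlacedBoth Y)
         (same : SameOrder X Y) where
  private
    module X = Skeleton X
    module Y = Skeleton Y

  corrV-t : ∀ {x y} → CorrE X Y x y → CorrV X Y (X.t x) (Y.t y)
  corrV-t c = corrV-unop {X = X} {Y} (corrV-s (op-skeleton X) (op-skeleton Y) (op-placed {S = X} placedX) (op-placed {S = Y} placedY)
                (sameOrder-op {X = X} {Y} same) (corrE-op {X = X} {Y} c))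

  corrV-total : ∀ z → ∃ (CorrV X Y z)
  corrV-total z with X.vertex z
  ... | inj₁ (v , eq) = Y.φ₀ v , inj₁ (v , eq , refl)
  ... | inj₂ (inj₁ src) with X.source-out src
  ... | x , refl = let y , c = corrE-total X Y x in Y.s y , corrV-s X Y placedX placedY same c
  corrV-total z | inj₂ (inj₂ snk) with X.sink-in snk
  ... | x , refl = let y , c = corrE-total X Y x in Y.t y , corrV-t c

module Isomorphism {G : Digraph} (X Y : Skeleton G) (placedX : WellPlacedBoth X) (placedY : WellPlacedBoth Y)
                   (same : SameOrder X Y) where
  private
    module X = Skeleton X
    module Y = Skeleton Y
    module XΓ = Digraph X.Γ
    module YΓ = Digraph Y.Γ
    same′ : SameOrder Y X
    same′ e f = mk⇔ (Equivalence.from (same e f)) (Equivalence.to (same e f))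

    inverse : {A B : Set} {R : A → B → Set} (R-total : ∀ a → ∃ (R a)) (R-total′ : ∀ b → ∃[ a ] R a b) →
              (∀ {a b b′} → R a b → R a b′ → b ≡ b′) → (∀ {a a′ b} → R a b → R a′ b → a ≡ a′) → A ↔ B
    inverse total total′ functional injective = mk↔ₛ′ (proj₁ ∘ total) (proj₁ ∘ total′)
      (λ b → functional (proj₂ (total (proj₁ (total′ b)))) (proj₂ (total′ b)))
      (λ a → injective (proj₂ (total′ (proj₁ (total a)))) (proj₂ (total a)))

  edges : XΓ.E ↔ YΓ.E
  edges = inverse {R = CorrE X Y} (corrE-total X Y)
    (λ y → let x , c = corrE-total Y X y in x , corrE-sym {X = Y} {X} c)
    (corrE-functional X Y)
    (λ c c′ → corrE-functional Y X (corrE-sym {X = X} {Y} c) (corrE-sym {X = X} {Y} c′))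

  vertices : XΓ.V ↔ YΓ.V
  vertices = inverse {R = CorrV X Y} (corrV-total X Y placedX placedY same)
    (λ y → let x , c = corrV-total Y X placedY placedX same′ y in x , corrV-sym {X = Y} {X} c)
    (corrV-functional X Y)
    (λ c c′ → corrV-functional Y X (corrV-sym {X = X} {Y} c) (corrV-sym {X = X} {Y} c′))

  λ₀ : XΓ.V → YΓ.V
  λ₀ = Inverse.to vertices
  λ₁ : XΓ.E → YΓ.E
  λ₁ = Inverse.to edges

  corr-λ₁ : ∀ x → CorrE X Y x (λ₁ x)
  corr-λ₁ x = proj₂ (corrE-total X Y x)

  corr-λ₀ : ∀ z → CorrV X Y z (λ₀ z)
  corr-λ₀ z = proj₂ (corrV-total X Y placedX placedY same z)

  s-λ : ∀ x → Y.s (λ₁ x) ≡ λ₀ (X.s x)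
  s-λ x = corrV-functional X Y (corrV-s X Y placedX placedY same (corr-λ₁ x)) (corr-λ₀ (X.s x))

  t-λ : ∀ x → Y.t (λ₁ x) ≡ λ₀ (X.t x)
  t-λ x = corrV-functional X Y (corrV-t X Y placedX placedY same (corr-λ₁ x)) (corr-λ₀ (X.t x))

  mono : ∀ {x y} → x X.≺ y → λ₁ x Y.≺ λ₁ y
  mono {x} {y} = corrE-mono X Y placedX placedY same (corr-λ₁ x) (corr-λ₁ y)

  λ∘φ₀ : ∀ v → Y.φ₀ v ≡ λ₀ (X.φ₀ v)
  λ∘φ₀ v = corrV-functional X Y (inj₁ (v , refl , refl)) (corr-λ₀ _)

  λ∘φ₁ : ∀ e → Y.φ₁ e ≡ λ₁ (X.φ₁ e)
  λ∘φ₁ e = corrE-functional X Y (inj₁ (e , refl , refl)) (corr-λ₁ _)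

abstract
  parts : ∀ a b c → Fin (a + b + c) ↔ (Fin a ⊎ Fin b ⊎ Fin c)
  parts a b c = ↔-trans Fin.+↔⊎ (↔-trans (Fin.+↔⊎ ⊎-↔ ↔-refl) (⊎-assoc 0ℓ _ _ _))

-- The skeleton of a given CPP-extension

module FromCPP {G : Digraph} (X : CPPExtension G) where
  private module G = Graph G
  open CPPExtension X
  open StrictOrder isStrictTotalOrder using (≺⇒≢; ≺-trans)
  private
    module Γ = Graph Γ
    module S = Enumeration G.source?
    module T = Enumeration G.sink?
  open Γ using (s; t)
  open Graph.Processive processive

  private
    inner-in : ∀ v → ∃[ x ] t x ≡ φ₀ v
    inner-in v with any? (Γ.in? (φ₀ v))
    ... | yes e = e
    ... | no ¬e = ⊥-elim (proj₁ E₁ (v , refl) (inj₁ (λ e te → ¬e (e , te))))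

    inner-out : ∀ v → ∃[ x ] s x ≡ φ₀ v
    inner-out v with any? (Γ.out? (φ₀ v))
    ... | yes e = e
    ... | no ¬e = ⊥-elim (proj₁ E₁ (v , refl) (inj₂ (λ e se → ¬e (e , se))))

    vertex : ∀ z → Image φ₀ z ⊎ z ∈ Γ.Source ⊎ z ∈ Γ.Sink
    vertex z with Γ.source? z | Γ.sink? z
    ... | yes src | _       = inj₂ (inj₁ src)
    ... | no _    | yes snk = inj₂ (inj₂ snk)
    ... | no ¬src | no ¬snk = inj₁ (proj₂ E₁ [ ¬src , ¬snk ]′)

    source-card : ∀ {z} → z ∈ Γ.Source → card (Γ.out? z) ≡ 1
    source-card {z} src = subst (λ n → n + card (Γ.out? z) ≡ 1) (card≡0 (Γ.in? z) src) (source-degree src)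

    sink-card : ∀ {z} → z ∈ Γ.Sink → card (Γ.in? z) ≡ 1
    sink-card {z} snk = trans (sym (ℕ.+-identityʳ _))
      (subst (λ n → card (Γ.in? z) + n ≡ 1) (card≡0 (Γ.out? z) snk) (sink-degree snk))

    Parts : Set
    Parts = G.E ⊎ Fin (card G.source?) ⊎ Fin (card G.sink?)

    place : Parts → Γ.E
    place (inj₁ e)        = φ₁ e
    place (inj₂ (inj₁ i)) = proj₁ (inner-in (S.elem i))
    place (inj₂ (inj₂ j)) = proj₁ (inner-out (T.elem j))

    t-in : ∀ {v} x → t x ≡ φ₀ v → ∀ i → proj₁ (inner-in (S.elem i)) ≡ x → S.elem i ≡ v
    t-in x tx i refl = φ₀-injective (trans (sym (proj₂ (inner-in (S.elem i)))) tx)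

    s-out : ∀ {v} x → s x ≡ φ₀ v → ∀ j → proj₁ (inner-out (T.elem j)) ≡ x → T.elem j ≡ v
    s-out x sx j refl = φ₀-injective (trans (sym (proj₂ (inner-out (T.elem j)))) sx)

    old-in : ∀ e i → φ₁ e ≢ proj₁ (inner-in (S.elem i))
    old-in e i eq = S.elem-∈ i e (sym (t-in (φ₁ e) (t-φ e) i (sym eq)))

    old-out : ∀ e j → φ₁ e ≢ proj₁ (inner-out (T.elem j))
    old-out e j eq = T.elem-∈ j e (sym (s-out (φ₁ e) (s-φ e) j (sym eq)))

    in-out : ∀ i j → proj₁ (inner-in (S.elem i)) ≢ proj₁ (inner-out (T.elem j))
    in-out i j eq = E₃ (S.elem-∈ i) (T.elem-∈ j)
      (_ , proj₂ (inner-in (S.elem i)) , trans (cong s eq) (proj₂ (inner-out (T.elem j))))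

    -- Stubs of one kind are told apart by the vertex of G that they serve, old edges neither enter
    -- sources nor leave sinks of G, and E₃ separates the two kinds of stubs.
    place-injective : Injective _≡_ _≡_ place
    place-injective {inj₁ e} {inj₁ f} eq = cong inj₁ (φ₁-injective eq)
    place-injective {inj₂ (inj₁ i)} {inj₂ (inj₁ j)} eq = cong (inj₂ ∘ inj₁)
      (S.elem-injective (t-in _ (proj₂ (inner-in (S.elem j))) i eq))
    place-injective {inj₂ (inj₂ i)} {inj₂ (inj₂ j)} eq = cong (inj₂ ∘ inj₂)
      (T.elem-injective (s-out _ (proj₂ (inner-out (T.elem j))) i eq))
    place-injective {inj₁ e} {inj₂ (inj₁ i)} eq = ⊥-elim (old-in e i eq)
    place-injective {inj₁ e} {inj₂ (inj₂ j)} eq = ⊥-elim (old-out e j eq)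
    place-injective {inj₂ (inj₁ i)} {inj₁ e} eq = ⊥-elim (old-in e i (sym eq))
    place-injective {inj₂ (inj₂ j)} {inj₁ e} eq = ⊥-elim (old-out e j (sym eq))
    place-injective {inj₂ (inj₁ i)} {inj₂ (inj₂ j)} eq = ⊥-elim (in-out i j eq)
    place-injective {inj₂ (inj₂ j)} {inj₂ (inj₁ i)} eq = ⊥-elim (in-out i j (sym eq))

    -- By E₂ there is no room for further edges.
    place-surjective : ∀ x → ∃[ p ] place p ≡ x
    place-surjective x = let k , eq = injective⇒surjective {f = place ∘ to} E₂ (to-injective ∘ place-injective) x
                         in to k , eq
      where
      open Inverse (parts G.#E (card G.source?) (card G.sink?)) using (to; from; strictlyInverseʳ)
      to-injective : Injective _≡_ _≡_ to
      to-injective {k} {l} eq = trans (sym (strictlyInverseʳ k)) (trans (cong from eq) (strictlyInverseʳ l))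

    in-canonical : ∀ {v x} → v ∈ G.Source → t x ≡ φ₀ v → proj₁ (inner-in v) ≡ x
    in-canonical {v} {x} src tx with place-surjective x
    ... | inj₁ e , refl = ⊥-elim (src e (φ₀-injective (trans (sym (t-φ e)) tx)))
    ... | inj₂ (inj₁ i) , eq = trans (cong (proj₁ ∘ inner-in) (sym (t-in x tx i eq))) eq
    ... | inj₂ (inj₂ j) , refl = ⊥-elim (E₃ src (T.elem-∈ j) (_ , tx , proj₂ (inner-out (T.elem j))))

    out-canonical : ∀ {v x} → v ∈ G.Sink → s x ≡ φ₀ v → proj₁ (inner-out v) ≡ x
    out-canonical {v} {x} snk sx with place-surjective x
    ... | inj₁ e , refl = ⊥-elim (snk e (φ₀-injective (trans (sym (s-φ e)) sx)))
    ... | inj₂ (inj₂ j) , eq = trans (cong (proj₁ ∘ inner-out) (sym (s-out x sx j eq))) eq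
    ... | inj₂ (inj₁ i) , refl = ⊥-elim (E₃ (S.elem-∈ i) snk (_ , proj₂ (inner-in (S.elem i)) , sx))

  skeleton : Skeleton G
  skeleton = record
    { Γ             = Γ
    ; _≺_           = _≺_
    ; sto           = isStrictTotalOrder
    ; embedding     = embedding
    ; inner-in      = inner-in
    ; inner-out     = inner-out
    ; vertex        = vertex
    ; source-out    = λ {z} src → card≡1⇒∃ (Γ.out? z) (source-card src)
    ; sink-in       = λ {z} snk → card≡1⇒∃ (Γ.in? z) (sink-card snk)
    ; source-unique = λ {z} src → card≡1⇒unique (Γ.out? z) (source-card src)
    ; sink-unique   = λ {z} snk → card≡1⇒unique (Γ.in? z) (sink-card snk)
    ; edge          = edge
    ; in-unique     = λ src tx ty → trans (sym (in-canonical src tx)) (in-canonical src ty)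
    ; out-unique    = λ snk sx sy → trans (sym (out-canonical snk sx)) (out-canonical snk sy)
    ; disjoint      = λ (v , src , tx) (w , snk , sx) → E₃ src snk (_ , tx , sx)
    }
    where
    edge : ∀ x → _
    edge x with place-surjective x
    ... | inj₁ e , eq          = inj₁ (e , eq)
    ... | inj₂ (inj₁ i) , refl = inj₂ (inj₁ (S.elem i , S.elem-∈ i , proj₂ (inner-in (S.elem i))))
    ... | inj₂ (inj₂ j) , refl = inj₂ (inj₂ (T.elem j , T.elem-∈ j , proj₂ (inner-out (T.elem j))))

  interlocked : Interlocked skeleton
  interlocked = record
    { flow       = λ {x} eq → P₁ ((λ { refl → acyclic x [ eq ] }) , [ eq ])
    ; planar     = λ walk e≺y y≺f → [ inj₁ ∘ proj₂ , inj₂ ∘ proj₂ ]′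
                     (P₂ e≺y y≺f (≺⇒≢ (≺-trans e≺y y≺f) , walk))
    ; inside-in  = inside-in
    ; inside-out = inside-out
    }
    where
    open Skeleton skeleton using (InStub; OutStub)
    inside-in : ∀ {x} → InStub x → s x ∈ Γ.Source ⊎ ∃[ a ] ∃[ b ] s a ≡ s x × s b ≡ s x × a ≺ x × x ≺ b
    inside-in {x} (v , src , tx) with Γ.source? (s x)
    ... | yes input = inj₁ input
    ... | no ¬input with E₄ {x} [ (λ old → old-not-in skeleton old (v , src , tx))
                                , [ ¬input , (λ output → let y , sy = inner-out v in output y (trans sy (sym tx))) ]′ ]′
    ... | inj₁ (a , b , (sa , _) , (sb , _) , a≺x , x≺b) = inj₂ (a , b , sa , sb , a≺x , x≺b)
    ... | inj₂ (a , _ , (ta , _) , _ , a≺x , _) =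
      ⊥-elim (≺⇒≢ a≺x (Skeleton.in-unique skeleton src (trans ta tx) tx))

    inside-out : ∀ {x} → OutStub x → t x ∈ Γ.Sink ⊎ ∃[ a ] ∃[ b ] t a ≡ t x × t b ≡ t x × x ≺ a × b ≺ x
    inside-out {x} (v , snk , sx) with Γ.sink? (t x)
    ... | yes output = inj₁ output
    ... | no ¬output with E₄ {x} [ (λ old → old-not-in (op-skeleton skeleton) old (v , snk , sx))
                                 , [ (λ input → let y , ty = inner-in v in input y (trans ty (sym sx))) , ¬output ]′ ]′
    ... | inj₂ (a , b , (ta , _) , (tb , _) , a≺x , x≺b) = inj₂ (b , a , tb , ta , x≺b , a≺x)
    ... | inj₁ (a , _ , (sa , _) , _ , a≺x , _) =
      ⊥-elim (≺⇒≢ a≺x (Skeleton.out-unique skeleton snk (trans sa sx) sx))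

  module _ (no-isolated : G.NoIsolatedVertices) where

    placed : WellPlacedBoth skeleton
    placed = interlocked⇒wellPlacedIn no-isolated interlocked
           , interlocked⇒wellPlacedIn (λ v (p , q) → no-isolated v (q , p)) (op-interlocked interlocked)

    restriction : UpwardPlanarOrder G
    restriction = upwardPlanarOrder (on-sto φ₁-injective isStrictTotalOrder)
      (restrict-upward {S = skeleton} (proj₁ placed) (proj₂ placed) (interlocked⇒upward interlocked))

module _ {G : Digraph} (no-isolated : Graph.NoIsolatedVertices G) where

  sameOrder⇒≈ᶜ : ∀ {X Y : CPPExtension G} →
                 SameOrder (FromCPP.skeleton X) (FromCPP.skeleton Y) → X ≈ᶜ Y
  sameOrder⇒≈ᶜ {X} {Y} same = record
    { vertices = vertices
    ; edges    = edges
    ; s-λ      = s-λ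
    ; t-λ      = t-λ
    ; mono     = mono
    ; λ∘φ₀     = λ∘φ₀
    ; λ∘φ₁     = λ∘φ₁
    }
    where open Isomorphism (FromCPP.skeleton X) (FromCPP.skeleton Y)
            (FromCPP.placed X no-isolated) (FromCPP.placed Y no-isolated) same

-- Existence of the extension

module Sources (G : Digraph) {_≺_ : Rel (Digraph.E G) 0ℓ} (sto : IsStrictTotalOrder _≡_ _≺_)
               (no-isolated : Graph.NoIsolatedVertices G) where
  open Graph G
  open StrictOrder sto
  open Enumeration source? public using () renaming
    (elem to source; elem-∈ to source-∈; elem-injective to source-injective;
     position to sourceIndex; elem-position to source-sourceIndex)

  #S : ℕ
  #S = card source?

  -- The stub does not exist yet; its future neighbour, the anchor o = min O(v), is tested in its
  -- place.
  Enclosing : E → Pred E 0ℓ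
  Enclosing o a = a ≺ o × ∃[ b ] s b ≡ s a × o ≺ b

  abstract
    enclosing? : ∀ o → Decidable (Enclosing o)
    enclosing? o a = (a <? o) ×-dec any? (λ b → (s b ≟ s a) ×-dec (o <? b))

    first-out : ∀ i → ∃ (IsMin (Out (source i)))
    first-out i with any? (out? (source i))
    ... | yes e = ≺-min sto (out? (source i)) e
    ... | no ¬e = ⊥-elim (no-isolated (source i) (source-∈ i , λ e se → ¬e (e , se)))

  anchor : Fin #S → E
  anchor i = proj₁ (first-out i)

  s-anchor : ∀ i → s (anchor i) ≡ source i
  s-anchor i = proj₁ (proj₂ (first-out i))

  anchor-least : ∀ i {f} → s f ≡ source i → anchor i ≼ f
  anchor-least i = proj₂ (proj₂ (first-out i))

  Unenclosed : Pred (Fin #S) 0ℓ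
  Unenclosed i = ∀ a → ¬ Enclosing (anchor i) a

  abstract
    unenclosed? : Decidable Unenclosed
    unenclosed? i = all? (λ a → ¬? (enclosing? (anchor i) a))

  open Enumeration unenclosed? public using () renaming
    (elem to input; elem-∈ to input-∈; elem-injective to input-injective;
     position to inputIndex; elem-position to input-inputIndex)

  #I : ℕ
  #I = card unenclosed?

  -- Where the stub starts, with the reason: at the vertex of the last opening edge, or at a fresh
  -- source of which there is one for each unenclosed anchor.
  data Tail (i : Fin #S) : V ⊎ Fin #I → Set where
    attached : ∀ {a} → IsMax (Enclosing (anchor i)) a → Tail i (inj₁ (s a))
    free     : ∀ {k} → input k ≡ i → Unenclosed i → Tail i (inj₂ k)

  abstract
    innermost : ∀ i → ∃ (Tail i)
    innermost i with any? (enclosing? (anchor i))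
    ... | yes a = _ , attached (proj₂ (≺-max sto (enclosing? (anchor i)) a))
    ... | no ¬a = _ , free (input-inputIndex unenclosed) unenclosed
      where
      unenclosed : Unenclosed i
      unenclosed a enc = ¬a (a , enc)

  tail : Fin #S → V ⊎ Fin #I
  tail i = proj₁ (innermost i)

  tail-view : ∀ i → Tail i (tail i)
  tail-view i = proj₂ (innermost i)

  input-tail : ∀ k → tail (input k) ≡ inj₂ k
  input-tail k = go (tail-view (input k))
    where
    go : ∀ {r} → Tail (input k) r → r ≡ inj₂ k
    go (attached {a} (enc , _)) = ⊥-elim (input-∈ k a enc)
    go (free eq _)              = cong inj₂ (input-injective eq)

module _ {G Γ : Digraph} {_≺ᴳ_ : Rel (Digraph.E G) 0ℓ} {_≺_ : Rel (Digraph.E Γ) 0ℓ}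
         (stoᴳ : IsStrictTotalOrder _≡_ _≺ᴳ_) (sto : IsStrictTotalOrder _≡_ _≺_)
         (φ : Embedding G Γ) (no-isolated : Graph.NoIsolatedVertices G) where
  private
    module G = Graph G
    module Γ = Graph Γ
  open Embedding φ
  open Sources G stoᴳ no-isolated
  open StrictOrder sto

  Start : Fin #S → Γ.E → Set
  Start i x = (∃[ a ] Order.IsMax _≺ᴳ_ (Enclosing (anchor i)) a × Γ.s x ≡ φ₀ (G.s a))
            ⊎ (Unenclosed i × Γ.s x ∈ Γ.Source)

  record Anchored (i : Fin #S) (x : Γ.E) : Set where
    field
      x≺anchor  : x ≺ φ₁ (anchor i)
      immediate : ∀ {y} → y ≺ φ₁ (anchor i) → ¬ (x ≺ y)
      start     : Start i x

  -- Since x is immediately before its anchor, a pair from G encloses x exactly when it encloses the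
  -- anchor, so the choice made in `Sources` is the one that `attach` asks for.
  anchored⇒wellPlaced : (∀ {e f} → e ≺ᴳ f ⇔ φ₁ e ≺ φ₁ f) →
    (∀ {v x} → v ∈ G.Source → Γ.t x ≡ φ₀ v → ∃[ i ] source i ≡ v × Anchored i x) →
    WellPlaced G Γ _≺_ φ
  anchored⇒wellPlaced iff anchored = record { tight = tight ; attach = attach }
    where
    tight : ∀ {v x} → v ∈ G.Source → Γ.t x ≡ φ₀ v →
            ∃[ o ] G.s o ≡ v × x ≺ φ₁ o × (∀ {f} → G.s f ≡ v → ¬ (φ₁ f ≺ φ₁ o)) ×
                   (∀ {y} → y ≺ φ₁ o → ¬ (x ≺ y))
    tight src tx with anchored src tx
    ... | i , refl , A = anchor i , s-anchor i , x≺anchor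
                       , (λ sf f≺o → StrictOrder.≼⇒⊁ stoᴳ (anchor-least i sf) (Equivalence.from iff f≺o))
                       , immediate
      where open Anchored A

    attach : ∀ {v x} → v ∈ G.Source → Γ.t x ≡ φ₀ v → Attached G Γ _≺_ φ x ⊎ Free G Γ _≺_ φ x
    attach {v} {x} src tx with anchored src tx
    ... | i , refl , A = finish start
      where
      open Anchored A

      enclosing : ∀ {c d} → Encloses G Γ _≺_ φ c d x → Enclosing (anchor i) c
      enclosing {c} {d} (scd , c≺x , x≺d) = c≺o , d , sym scd , o≺d
        where
        c≺o : c ≺ᴳ anchor i
        c≺o = Equivalence.from iff (≺-trans c≺x x≺anchor)
        -- Were d the anchor, c would leave the same source before its least outgoing edge.
        o≢d : anchor i ≢ d
        o≢d eq = StrictOrder.≼⇒⊁ stoᴳ (anchor-least i (trans scd (trans (cong G.s (sym eq)) (s-anchor i)))) c≺o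
        o≺d : anchor i ≺ᴳ d
        o≺d = StrictOrder.≼∧≢⇒≺ stoᴳ
          (StrictOrder.⊁⇒≼ stoᴳ (λ d≺o → immediate (Equivalence.to iff d≺o) x≺d)) o≢d

      encloses : ∀ {a} → ((a≺o , b , _) : Enclosing (anchor i) a) → Encloses G Γ _≺_ φ a b x
      encloses {a} (a≺o , b , sba , o≺b) =
        sym sba , ≼∧≢⇒≺ (⊁⇒≼ (immediate (Equivalence.to iff a≺o))) a≢x
                , ≺-trans x≺anchor (Equivalence.to iff o≺b)
        where
        a≢x : φ₁ a ≢ x
        a≢x refl = src a (φ₀-injective (trans (sym (t-φ a)) tx))

      finish : Start i x → Attached G Γ _≺_ φ x ⊎ Free G Γ _≺_ φ x
      finish (inj₁ (a , (enc , max) , sx)) =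
        inj₁ (a , sx , (proj₁ (proj₂ enc) , encloses enc) ,
              λ enc′ a≺c → StrictOrder.≼⇒⊁ stoᴳ (max (enclosing enc′)) (Equivalence.from iff a≺c))
      finish (inj₂ (unenclosed , input)) = inj₂ (input , λ {c} {_} enc → unenclosed c (enclosing enc))

module Construction (G : Digraph) {_≺ᴳ_ : Rel (Digraph.E G) 0ℓ} (stoᴳ : IsStrictTotalOrder _≡_ _≺ᴳ_)
                    (no-isolated : Graph.NoIsolatedVertices G) where
  private
    module G = Graph G

    no-isolated′ : Graph.NoIsolatedVertices (op G)
    no-isolated′ v (p , q) = no-isolated v (q , p)

    module S = Sources G stoᴳ no-isolated
    module T = Sources (op G) (flip-sto stoᴳ) no-isolated′
    module GO = StrictOrder stoᴳ

    EParts VParts : Set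
    EParts = G.E ⊎ Fin S.#S ⊎ Fin T.#S
    VParts = G.V ⊎ Fin S.#I ⊎ Fin T.#I

    pattern old e  = inj₁ e
    pattern into i = inj₂ (inj₁ i)
    pattern from j = inj₂ (inj₂ j)

    sP tP : EParts → VParts
    sP (old e)  = old (G.s e)
    sP (into i) = [ inj₁ , inj₂ ∘ inj₁ ]′ (S.tail i)
    sP (from j) = old (T.source j)
    tP (old e)  = old (G.t e)
    tP (into i) = old (S.source i)
    tP (from j) = [ inj₁ , inj₂ ∘ inj₂ ]′ (T.tail j)

    -- The keys that the uniqueness argument reads off an extension are imposed here to define its
    -- order.
    keyP : EParts → G.E × Fin 3
    keyP (old e)  = e , suc zero
    keyP (into i) = S.anchor i , zero
    keyP (from j) = T.anchor j , suc (suc zero)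

    keyP-injective : Injective _≡_ _≡_ keyP
    keyP-injective {old e} {old f} refl = refl
    keyP-injective {into i} {into j} eq = cong (inj₂ ∘ inj₁) (S.source-injective
      (trans (sym (S.s-anchor i)) (trans (cong (G.s ∘ proj₁) eq) (S.s-anchor j))))
    keyP-injective {from i} {from j} eq = cong (inj₂ ∘ inj₂) (T.source-injective
      (trans (sym (T.s-anchor i)) (trans (cong (G.t ∘ proj₁) eq) (T.s-anchor j))))
    keyP-injective {old e} {into i} ()
    keyP-injective {old e} {from j} ()
    keyP-injective {into i} {old e} ()
    keyP-injective {into i} {from j} ()
    keyP-injective {from j} {old e} ()
    keyP-injective {from j} {into i} ()

    module EI = Inverse (parts G.#E S.#S T.#S)
    module VI = Inverse (parts G.#V S.#I T.#I)

  Γ : Digraph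
  Γ = record
    { #V = G.#V + S.#I + T.#I
    ; #E = G.#E + S.#S + T.#S
    ; s  = VI.from ∘ sP ∘ EI.to
    ; t  = VI.from ∘ tP ∘ EI.to
    }

  private module Γ = Graph Γ

  _≺_ : Rel Γ.E 0ℓ
  _≺_ = Key< _≺ᴳ_ on (keyP ∘ EI.to)

  private
    EI-to-injective : Injective _≡_ _≡_ EI.to
    EI-to-injective {x} {y} eq = trans (sym (EI.strictlyInverseʳ x)) (trans (cong EI.from eq) (EI.strictlyInverseʳ y))

    EI-from-injective : Injective _≡_ _≡_ EI.from
    EI-from-injective {p} {q} eq = trans (sym (EI.strictlyInverseˡ p)) (trans (cong EI.to eq) (EI.strictlyInverseˡ q))

    VI-from-injective : Injective _≡_ _≡_ VI.from
    VI-from-injective {p} {q} eq = trans (sym (VI.strictlyInverseˡ p)) (trans (cong VI.to eq) (VI.strictlyInverseˡ q))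

  sto : IsStrictTotalOrder _≡_ _≺_
  sto = on-sto (EI-to-injective ∘ keyP-injective) (key-sto stoᴳ)

  private
    φ₀ : G.V → Γ.V
    φ₀ v = VI.from (old v)

    φ₁ : G.E → Γ.E
    φ₁ e = EI.from (old e)

    to-φ₁ : ∀ e → EI.to (φ₁ e) ≡ old e
    to-φ₁ e = EI.strictlyInverseˡ (old e)

    old-injective : ∀ {A B : Set} {a a′ : A} → inj₁ {B = B} a ≡ inj₁ a′ → a ≡ a′
    old-injective refl = refl

  embedding : Embedding G Γ
  embedding = record
    { φ₀           = φ₀
    ; φ₁           = φ₁
    ; φ₀-injective = old-injective ∘ VI-from-injective
    ; φ₁-injective = old-injective ∘ EI-from-injective
    ; s-φ          = λ e → cong (VI.from ∘ sP) (to-φ₁ e)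
    ; t-φ          = λ e → cong (VI.from ∘ tP) (to-φ₁ e)
    }

  φ₁-order : ∀ {e f} → e ≺ᴳ f ⇔ φ₁ e ≺ φ₁ f
  φ₁-order {e} {f} = mk⇔
    (λ e≺f → subst₂ (λ p q → Key< _≺ᴳ_ (keyP p) (keyP q)) (sym (to-φ₁ e)) (sym (to-φ₁ f)) (inj₁ e≺f))
    (λ φe≺φf → reflect (subst₂ (λ p q → Key< _≺ᴳ_ (keyP p) (keyP q)) (to-φ₁ e) (to-φ₁ f) φe≺φf))
    where
    reflect : Key< _≺ᴳ_ (e , suc zero) (f , suc zero) → e ≺ᴳ f
    reflect (inj₁ e≺f)          = e≺f
    reflect (inj₂ (_ , s≤s ()))

  private
    at : ∀ x {p} → EI.to x ≡ p → x ≡ EI.from p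
    at x eq = trans (sym (EI.strictlyInverseʳ x)) (cong EI.from eq)

    s-from : ∀ p → Γ.s (EI.from p) ≡ VI.from (sP p)
    s-from p = cong (VI.from ∘ sP) (EI.strictlyInverseˡ p)

    t-from : ∀ p → Γ.t (EI.from p) ≡ VI.from (tP p)
    t-from p = cong (VI.from ∘ tP) (EI.strictlyInverseˡ p)

    s≡ : ∀ {x q} → Γ.s x ≡ VI.from q → sP (EI.to x) ≡ q
    s≡ = VI-from-injective

    t≡ : ∀ {x q} → Γ.t x ≡ VI.from q → tP (EI.to x) ≡ q
    t≡ = VI-from-injective

    -- A stub out of a sink attaches only at the end of an edge of G, which is no source.
    into-view : ∀ {v} → v ∈ G.Source → ∀ p → tP p ≡ old v → ∃[ i ] p ≡ into i × S.source i ≡ v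
    into-view src (old e) eq = ⊥-elim (src e (old-injective eq))
    into-view src (into i) eq = i , refl , old-injective eq
    into-view src (from j) eq = ⊥-elim (go (T.tail-view j) eq)
      where
      go : ∀ {r} → T.Tail j r → [ inj₁ , inj₂ ∘ inj₂ ]′ r ≢ old _
      go (T.attached {a} _) eq = src a (old-injective eq)
      go (T.free _ _) ()

    from-view : ∀ {v} → v ∈ G.Sink → ∀ p → sP p ≡ old v → ∃[ j ] p ≡ from j × T.source j ≡ v
    from-view snk (old e) eq = ⊥-elim (snk e (old-injective eq))
    from-view snk (from j) eq = j , refl , old-injective eq
    from-view snk (into i) eq = ⊥-elim (go (S.tail-view i) eq)
      where
      go : ∀ {r} → S.Tail i r → [ inj₁ , inj₂ ∘ inj₁ ]′ r ≢ old _
      go (S.attached {a} _) eq = snk a (old-injective eq)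
      go (S.free _ _) ()

    input-view : ∀ {k} p → sP p ≡ into k → p ≡ into (S.input k)
    input-view {k} (into i) eq = go (S.tail-view i) eq
      where
      go : ∀ {r} → S.Tail i r → [ inj₁ , inj₂ ∘ inj₁ ]′ r ≡ into k → inj₂ (inj₁ i) ≡ into (S.input k)
      go (S.free eq _) refl = cong (inj₂ ∘ inj₁) (sym eq)
      go (S.attached _) ()

    output-view : ∀ {k} p → tP p ≡ from k → p ≡ from (T.input k)
    output-view {k} (from j) eq = go (T.tail-view j) eq
      where
      go : ∀ {r} → T.Tail j r → [ inj₁ , inj₂ ∘ inj₂ ]′ r ≡ from k → inj₂ (inj₂ j) ≡ from (T.input k)
      go (T.free eq _) refl = cong (inj₂ ∘ inj₂) (sym eq)
      go (T.attached _) ()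

    no-in : ∀ {k} p → tP p ≢ into k
    no-in {k} (from j) eq = go (T.tail j) eq
      where
      go : ∀ r → [ inj₁ , inj₂ ∘ inj₂ ]′ r ≢ into k
      go (inj₁ _) ()
      go (inj₂ _) ()

    no-out : ∀ {k} p → sP p ≢ from k
    no-out {k} (into i) eq = go (S.tail i) eq
      where
      go : ∀ r → [ inj₁ , inj₂ ∘ inj₁ ]′ r ≢ from k
      go (inj₁ _) ()
      go (inj₂ _) ()

    input-source : ∀ k → VI.from (into k) ∈ Γ.Source
    input-source k x tx = no-in (EI.to x) (t≡ tx)

    output-sink : ∀ k → VI.from (from k) ∈ Γ.Sink
    output-sink k x sx = no-out (EI.to x) (s≡ sx)

    data VertexView : Γ.V → Set where
      vertex-view : ∀ q → VertexView (VI.from q)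

    view : ∀ z → VertexView z
    view z = subst VertexView (VI.strictlyInverseʳ z) (vertex-view (VI.to z))

    inner-in : ∀ v → ∃[ x ] Γ.t x ≡ φ₀ v
    inner-in v with G.source? v | any? (G.in? v)
    ... | yes src | _            = EI.from (into (S.sourceIndex src)) ,
      trans (t-from (into (S.sourceIndex src))) (cong φ₀ (S.source-sourceIndex src))
    ... | no _    | yes (e , te) = φ₁ e , trans (t-from (old e)) (cong φ₀ te)
    ... | no ¬src | no ¬e        = ⊥-elim (¬src (λ e te → ¬e (e , te)))

    inner-out : ∀ v → ∃[ x ] Γ.s x ≡ φ₀ v
    inner-out v with G.sink? v | any? (G.out? v)
    ... | yes snk | _            = EI.from (from (T.sourceIndex snk)) ,
      trans (s-from (from (T.sourceIndex snk))) (cong φ₀ (T.source-sourceIndex snk))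
    ... | no _    | yes (e , se) = φ₁ e , trans (s-from (old e)) (cong φ₀ se)
    ... | no ¬snk | no ¬e        = ⊥-elim (¬snk (λ e se → ¬e (e , se)))

    input-out : ∀ k → ∃[ x ] Γ.s x ≡ VI.from (into k)
    input-out k = EI.from (into (S.input k)) ,
      trans (s-from (into (S.input k))) (cong (VI.from ∘ [ inj₁ , inj₂ ∘ inj₁ ]′) (S.input-tail k))

    output-in : ∀ k → ∃[ x ] Γ.t x ≡ VI.from (from k)
    output-in k = EI.from (from (T.input k)) ,
      trans (t-from (from (T.input k))) (cong (VI.from ∘ [ inj₁ , inj₂ ∘ inj₂ ]′) (T.input-tail k))

  skeleton : Skeleton G
  skeleton = record
    { Γ             = Γ
    ; _≺_           = _≺_
    ; sto           = sto
    ; embedding     = embedding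
    ; inner-in      = inner-in
    ; inner-out     = inner-out
    ; vertex        = λ z → vertex (view z)
    ; source-out    = λ {z} → source-out (view z)
    ; sink-in       = λ {z} → sink-in (view z)
    ; source-unique = λ {z} → source-unique (view z)
    ; sink-unique   = λ {z} → sink-unique (view z)
    ; edge          = λ x → edge (EI.to x) refl
    ; in-unique     = in-unique
    ; out-unique    = out-unique
    ; disjoint      = disjoint
    }
    where
    vertex : ∀ {z} → VertexView z → Image φ₀ z ⊎ z ∈ Γ.Source ⊎ z ∈ Γ.Sink
    vertex (vertex-view (old v))  = inj₁ (v , refl)
    vertex (vertex-view (into k)) = inj₂ (inj₁ (input-source k))
    vertex (vertex-view (from k)) = inj₂ (inj₂ (output-sink k))

    source-out : ∀ {z} → VertexView z → z ∈ Γ.Source → ∃[ x ] Γ.s x ≡ z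
    source-out (vertex-view (old v))  src = let x , tx = inner-in v in ⊥-elim (src x tx)
    source-out (vertex-view (into k)) src = input-out k
    source-out (vertex-view (from k)) src = let x , tx = output-in k in ⊥-elim (src x tx)

    sink-in : ∀ {z} → VertexView z → z ∈ Γ.Sink → ∃[ x ] Γ.t x ≡ z
    sink-in (vertex-view (old v))  snk = let x , sx = inner-out v in ⊥-elim (snk x sx)
    sink-in (vertex-view (into k)) snk = let x , sx = input-out k in ⊥-elim (snk x sx)
    sink-in (vertex-view (from k)) snk = output-in k

    source-unique : ∀ {z x y} → VertexView z → z ∈ Γ.Source → Γ.s x ≡ z → Γ.s y ≡ z → x ≡ y
    source-unique (vertex-view (old v)) src _ _ = let x , tx = inner-in v in ⊥-elim (src x tx)
    source-unique {x = x} {y} (vertex-view (into k)) src sx sy =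
      EI-to-injective (trans (input-view _ (s≡ sx)) (sym (input-view _ (s≡ sy))))
    source-unique (vertex-view (from k)) src _ _ = let x , tx = output-in k in ⊥-elim (src x tx)

    sink-unique : ∀ {z x y} → VertexView z → z ∈ Γ.Sink → Γ.t x ≡ z → Γ.t y ≡ z → x ≡ y
    sink-unique (vertex-view (old v)) snk _ _ = let x , sx = inner-out v in ⊥-elim (snk x sx)
    sink-unique (vertex-view (into k)) snk _ _ = let x , sx = input-out k in ⊥-elim (snk x sx)
    sink-unique {x = x} {y} (vertex-view (from k)) snk tx ty =
      EI-to-injective (trans (output-view _ (t≡ tx)) (sym (output-view _ (t≡ ty))))

    edge : ∀ {x} p → EI.to x ≡ p → Image φ₁ x ⊎
           (∃[ v ] v ∈ G.Source × Γ.t x ≡ φ₀ v) ⊎ (∃[ v ] v ∈ G.Sink × Γ.s x ≡ φ₀ v)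
    edge (old e)  eq = inj₁ (e , sym (at _ eq))
    edge (into i) eq = inj₂ (inj₁ (S.source i , S.source-∈ i , cong (VI.from ∘ tP) eq))
    edge (from j) eq = inj₂ (inj₂ (T.source j , T.source-∈ j , cong (VI.from ∘ sP) eq))

    in-unique : ∀ {v x y} → v ∈ G.Source → Γ.t x ≡ φ₀ v → Γ.t y ≡ φ₀ v → x ≡ y
    in-unique {x = x} {y} src tx ty with into-view src (EI.to x) (t≡ tx) | into-view src (EI.to y) (t≡ ty)
    ... | i , eq , si | j , eq′ , sj with S.source-injective (trans si (sym sj))
    ... | refl = EI-to-injective (trans eq (sym eq′))

    out-unique : ∀ {v x y} → v ∈ G.Sink → Γ.s x ≡ φ₀ v → Γ.s y ≡ φ₀ v → x ≡ y
    out-unique {x = x} {y} snk sx sy with from-view snk (EI.to x) (s≡ sx) | from-view snk (EI.to y) (s≡ sy)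
    ... | i , eq , si | j , eq′ , sj with T.source-injective (trans si (sym sj))
    ... | refl = EI-to-injective (trans eq (sym eq′))

    disjoint : ∀ {x} → (∃[ v ] v ∈ G.Source × Γ.t x ≡ φ₀ v) → (∃[ v ] v ∈ G.Sink × Γ.s x ≡ φ₀ v) → ⊥
    disjoint {x} (v , src , tx) (w , snk , sx) with into-view src (EI.to x) (t≡ tx) | from-view snk (EI.to x) (s≡ sx)
    ... | i , eq , _ | j , eq′ , _ with trans (sym eq) eq′
    ... | ()

  placedIn : WellPlacedIn skeleton
  placedIn = anchored⇒wellPlaced stoᴳ sto embedding no-isolated φ₁-order anchored
    where
    anchored : ∀ {v x} → v ∈ G.Source → Γ.t x ≡ φ₀ v →
               ∃[ i ] S.source i ≡ v × Anchored stoᴳ sto embedding no-isolated i x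
    anchored {v} {x} src tx with into-view src (EI.to x) (t≡ tx)
    ... | i , eq , si = i , si , record
      { x≺anchor  = subst₂ _<ᴾ_ (sym eq) (sym (to-φ₁ (S.anchor i))) (inj₂ (refl , s≤s z≤n))
      -- The keys (o , 0) and (o , 1) are neighbours.
      ; immediate = λ {y} y≺o x≺y → between (subst (EI.to y <ᴾ_) (to-φ₁ (S.anchor i)) y≺o)
                                            (subst (_<ᴾ EI.to y) eq x≺y)
      ; start     = start (S.tail i) (S.tail-view i) (cong sP eq)
      }
      where
      _<ᴾ_ : Rel EParts 0ℓ
      p <ᴾ q = Key< _≺ᴳ_ (keyP p) (keyP q)

      between : ∀ {k} → Key< _≺ᴳ_ k (S.anchor i , suc zero) → ¬ Key< _≺ᴳ_ (S.anchor i , zero) k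
      between (inj₁ k≺o) (inj₁ o≺k) = GO.asym k≺o o≺k
      between (inj₁ k≺o) (inj₂ (refl , _)) = GO.≺-irrefl k≺o
      between (inj₂ (refl , _)) (inj₁ o≺k) = GO.≺-irrefl o≺k
      between {_ , zero} (inj₂ _) (inj₂ (_ , ()))
      between {_ , suc _} (inj₂ (_ , s≤s ())) (inj₂ _)

      start : ∀ r → S.Tail i r → sP (EI.to x) ≡ [ inj₁ , inj₂ ∘ inj₁ ]′ r → Start stoᴳ sto embedding no-isolated i x
      start _ (S.attached max)       e = inj₁ (_ , max , cong VI.from e)
      start _ (S.free _ unenclosed) e = inj₂ (unenclosed , subst Γ.Source (sym (cong VI.from e)) (input-source _))

  placedOut : WellPlacedOut skeleton
  placedOut = anchored⇒wellPlaced (flip-sto stoᴳ) (flip-sto sto) (op-embedding embedding) no-isolated′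
                (λ {e} {f} → φ₁-order {f} {e}) anchored
    where
    anchored : ∀ {v x} → v ∈ G.Sink → Γ.s x ≡ φ₀ v → ∃[ j ] T.source j ≡ v ×
               Anchored (flip-sto stoᴳ) (flip-sto sto) (op-embedding embedding) no-isolated′ j x
    anchored {v} {x} snk sx with from-view snk (EI.to x) (s≡ sx)
    ... | j , eq , sj = j , sj , record
      { x≺anchor  = subst₂ _<ᴾ_ (sym (to-φ₁ (T.anchor j))) (sym eq) (inj₂ (refl , s≤s (s≤s z≤n)))
      ; immediate = λ {y} o≺y y≺x → between (subst (_<ᴾ EI.to y) (to-φ₁ (T.anchor j)) o≺y)
                                            (subst (EI.to y <ᴾ_) eq y≺x)
      ; start     = start (T.tail j) (T.tail-view j) (cong tP eq)
      }
      where
      _<ᴾ_ : Rel EParts 0ℓ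
      p <ᴾ q = Key< _≺ᴳ_ (keyP p) (keyP q)

      between : ∀ {k} → Key< _≺ᴳ_ (T.anchor j , suc zero) k → ¬ Key< _≺ᴳ_ k (T.anchor j , suc (suc zero))
      between (inj₁ o≺k) (inj₁ k≺o) = GO.asym k≺o o≺k
      between (inj₁ o≺k) (inj₂ (refl , _)) = GO.≺-irrefl o≺k
      between (inj₂ (refl , _)) (inj₁ k≺o) = GO.≺-irrefl k≺o
      between {_ , zero} (inj₂ (_ , ())) (inj₂ _)
      between {_ , suc zero} (inj₂ (_ , s≤s ())) (inj₂ _)
      between {_ , suc (suc _)} (inj₂ _) (inj₂ (_ , s≤s (s≤s ())))

      start : ∀ r → T.Tail j r → tP (EI.to x) ≡ [ inj₁ , inj₂ ∘ inj₂ ]′ r →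
              Start (flip-sto stoᴳ) (flip-sto sto) (op-embedding embedding) no-isolated′ j x
      start _ (T.attached max)       e = inj₁ (_ , max , cong VI.from e)
      start _ (T.free _ unenclosed) e = inj₂ (unenclosed , subst Γ.Sink (sym (cong VI.from e)) (output-sink _))

-- From skeletons to CPP-extensions

module _ {G : Digraph} (S : Skeleton G) where
  open Skeleton S
  open StrictOrder sto
  private module Γ = Graph Γ

  -- The edge count is an argument because a skeleton does not record it. E₄ holds for an attached
  -- stub because its enclosing pair lies in the family at its attached end.
  toCPP : Digraph.#E Γ ≡ Digraph.#E G + card (Graph.source? G) + card (Graph.sink? G) →
          (∀ {x y} → t x ≡ s y → x ≺ y) → Planar Γ _≺_ → WellPlacedBoth S → CPPExtension G
  toCPP #E≡ flow planar (placedIn , placedOut) = record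
    { pop = record
      { Γ           = Γ
      ; processive  = record
        { acyclic       = λ x walk → ≺-irrefl (walk⇒≺ walk)
        ; source-degree = λ {z} src → let x , sx = source-out src in
            cong₂ _+_ (card≡0 (Γ.in? z) src) (card≡1 (Γ.out? z) sx (source-unique src))
        ; sink-degree   = λ {z} snk → let x , tx = sink-in snk in
            cong₂ _+_ (card≡1 (Γ.in? z) tx (sink-unique snk)) (card≡0 (Γ.out? z) snk)
        }
      ; planarOrder = record
        { _≺_                = _≺_
        ; isStrictTotalOrder = sto
        ; P₁ = λ (_ , walk) → walk⇒≺ walk
        ; P₂ = λ e≺y y≺f (_ , walk) →
            [ (λ w → inj₁ (≺⇒≢ e≺y , w)) , (λ w → inj₂ (≺⇒≢ y≺f , w)) ]′ (planar walk e≺y y≺f)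
        }
      }
    ; embedding = embedding
    ; E₁ = (λ { (v , refl) → [ (λ src → source-not-inner S src refl)
                             , (λ snk → source-not-inner (op-skeleton S) snk refl) ]′ })
         , (λ {z} ¬boundary → [ id , ⊥-elim ∘ ¬boundary ]′ (vertex z))
    ; E₂ = #E≡
    ; E₃ = λ src snk (x , tx , sx) → disjoint (_ , src , tx) (_ , snk , sx)
    ; E₄ = λ {x} ¬old∪boundary → inside x (edge x) ¬old∪boundary
    }
    where
    open Walks {Γ} flow ≺-trans

    inside : ∀ x → Image φ₁ x ⊎ InStub x ⊎ OutStub x → ¬ (x ∈ Image φ₁ ∪ Γ.InputEdge ∪ Γ.OutputEdge) →
             x ∈ StrictlyInside (Γ.Out (s x)) ⊎ x ∈ StrictlyInside (Γ.In (t x))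
    inside x (inj₁ old) ¬new = ⊥-elim (¬new (inj₁ old))
    inside x (inj₂ (inj₁ (v , src , tx))) ¬new with WellPlaced.attach placedIn src tx
    ... | inj₂ (input , _) = ⊥-elim (¬new (inj₂ (inj₁ input)))
    ... | inj₁ (a , sx , (b , sab , a≺x , x≺b) , _) =
      inj₁ (between⇒StrictlyInside sto (Γ.out? (s x)) (trans (s-φ a) (sym sx))
             (trans (s-φ b) (trans (cong φ₀ (sym sab)) (sym sx))) a≺x x≺b)
    inside x (inj₂ (inj₂ (v , snk , sx))) ¬new with WellPlaced.attach placedOut snk sx
    ... | inj₂ (output , _) = ⊥-elim (¬new (inj₂ (inj₂ output)))
    ... | inj₁ (a , tx , (b , tab , x≺a , b≺x) , _) =
      inj₂ (between⇒StrictlyInside sto (Γ.in? (t x)) (trans (t-φ b) (trans (cong φ₀ (sym tab)) (sym tx)))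
             (trans (t-φ a) (sym tx)) b≺x x≺a)

-- The bijection

module _ {G : Digraph} (acyclic : Graph.Acyclic G) (no-isolated : Graph.NoIsolatedVertices G) where

  extension : UpwardPlanarOrder G → CPPExtension G
  extension P = toCPP skeleton refl (IsUpward.flow lifted)
    (lift-planar no-isolated skeleton placedIn placedOut restricted) (placedIn , placedOut)
    where
    module P = UpwardPlanarOrder P
    open Construction G P.isStrictTotalOrder no-isolated
    open Skeleton skeleton using (φ₁)

    restricted : IsUpward G (_≺_ on φ₁)
    restricted = upward-resp (λ _ _ → φ₁-order) (upward acyclic P)

    lifted : IsUpward Γ _≺_
    lifted = lift-upward no-isolated skeleton placedIn placedOut restricted

  extension-order : ∀ P {e f} → UpwardPlanarOrder._≺_ P e f ⇔
                    CPPExtension._≺_ (extension P) (CPPExtension.φ₁ (extension P) e) (CPPExtension.φ₁ (extension P) f)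
  extension-order P = Construction.φ₁-order G (UpwardPlanarOrder.isStrictTotalOrder P) no-isolated

≈ᶜ⇒sameOrder : ∀ {G} {X Y : CPPExtension G} → X ≈ᶜ Y → SameOrder (FromCPP.skeleton X) (FromCPP.skeleton Y)
≈ᶜ⇒sameOrder {X = X} {Y} iso e f = mk⇔ (transport iso) (transport (≈ᶜ-sym iso))
  where
  transport : ∀ {X Y} → X ≈ᶜ Y → CPPExtension._≺_ X (CPPExtension.φ₁ X e) (CPPExtension.φ₁ X f) →
              CPPExtension._≺_ Y (CPPExtension.φ₁ Y e) (CPPExtension.φ₁ Y f)
  transport {Y = Y} i lt = subst₂ (CPPExtension._≺_ Y) (sym (λ∘φ₁ e)) (sym (λ∘φ₁ f)) (mono lt)
    where open _≈ᶜ_ i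

theorem5p7 : (G : Digraph) → Graph.Acyclic G → Graph.NoIsolatedVertices G →
    Bijection (UpwardPlanarOrders G) (CPPExtensions G)
theorem5p7 G acyclic no-isolated = record
  { to        = to
  ; cong      = λ {P} {Q} P≈Q → sameOrder⇒≈ᶜ no-isolated {X = to P} {Y = to Q}
                  (λ e f → ⇔-trans (⇔-sym (order P)) (⇔-trans (P≈Q e f) (order Q)))
  ; bijective = (λ {P} {Q} iso e f → ⇔-trans (order P)
                  (⇔-trans (≈ᶜ⇒sameOrder {X = to P} {Y = to Q} iso e f) (⇔-sym (order Q))))
              -- The preimage of Y is the order that Y induces on E(G): its extension and Y then
              -- agree on E(G), and this agreement already yields an isomorphism.
              , λ Y → FromCPP.restriction Y no-isolated
                    , λ {P} P≈Y → sameOrder⇒≈ᶜ no-isolated {X = to P} {Y = Y} (λ e f → ⇔-trans (⇔-sym (order P)) (P≈Y e f))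
  }
  where
  to : UpwardPlanarOrder G → CPPExtension G
  to = extension acyclic no-isolated
  order : ∀ P {e f} → UpwardPlanarOrder._≺_ P e f ⇔
          CPPExtension._≺_ (to P) (CPPExtension.φ₁ (to P) e) (CPPExtension.φ₁ (to P) f)
  order = extension-order acyclic no-isolated
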